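{- For every integer $j\ge 0$, the following identity holds as formal power series in $q$: $$\sum_{m\ge j} \sum_{n\ge 0} M(m,n)\, q^n \;=\; \sum_{n\ge 0} \frac{q^{(n+1)(n+j)}}{(q;q)_n\, (q;q)_{n+j}}.$$
   Context: A partition of a positive integer $n$ is a finite weakly decreasing sequence of positive integers $\lambda=(\lambda_1\ge\lambda_2\ge\cdots\ge\lambda_r\ge 1)$ with sum $n$. Let $\omega(\lambda)$ be the number of parts of $\lambda$ equal to $1$ and $\mu(\lambda)$ the number of parts of $\lambda$ that are greater than $\omega(\lambda)$. The crank of $\lambda$ is $\mathrm{crank}(\lambda)=\lambda_1$ if $\omega(\lambda)=0$, and $\mathrm{crank}(\lambda)=\mu(\lambda)-\omega(\lambda)$ if $\omega(\lambda)>0$. For integers $m$ and $n>1$, $M(m,n)$ is the number of partitions of $n$ with crank $m$. For $n\in\{0,1\}$, by convention, $M(0,0)=1$, $M(1,1)=1$, $M(-1,1)=1$, $M(0,1)=-1$, and all other values $M(m,0)$, $M(m,1)$ are $0$. Notation: $(a;q)_n=(1-a)(1-aq)\cdots(1-aq^{n-1})$, with $(a;q)_0=1$. -}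

module Defs where

import Algebra.Properties.Semiring.Sum
open import Data.Fin.Base using (Fin; zero; suc; toℕ)
open import Data.Integer.Base as ℤ using (ℤ; +_; -[1+_]; _⊖_; 0ℤ; 1ℤ; -1ℤ)
import Data.Integer.Properties as ℤ
open import Data.List.Base using (List; []; _∷_; _++_; map; length; filter)
open import Data.List.Membership.Propositional using (_∈_)
open import Data.List.Membership.Propositional.Properties using (∈-map⁺; ∈-map⁻; ∈-++⁺ˡ; ∈-++⁺ʳ; ∈-++⁻; ∈-filter⁺; ∈-filter⁻)
open import Data.List.Properties using (∷-injectiveʳ)
open import Data.List.Relation.Unary.All as All using (All; []; _∷_)
open import Data.List.Relation.Unary.AllPairs using ([]; _∷_)
open import Data.List.Relation.Unary.Any using (here)
open import Data.List.Relation.Unary.Linked using (Linked; []; [-]; _∷_)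
open import Data.List.Relation.Binary.Disjoint.Propositional using (Disjoint)
open import Data.List.Relation.Unary.Unique.Propositional using (Unique)
open import Data.Nat.ListAction using (sum)
import Data.List.Relation.Unary.Unique.Propositional.Properties as Unique
open import Data.Nat.Base using (ℕ; zero; suc; _+_; _∸_; _≤_; _≥_; z≤n; s≤s)
open import Data.Nat.Properties using (_≟_; _<?_; ≤-refl; ≤-trans; m≤n⇒m≤1+n; m≤n⇒m<n∨m≡n; n≮n; +-mono-≤; m≤m+n; m≤n+m; m<1+n⇒m≤n)
open import Data.Product.Base using (_×_; _,_; ∃-syntax)
open import Data.Sum.Base using (inj₁; inj₂)
open import Data.Vec.Base as Vec using (Vec; lookup)
open import Function.Bundles using (_⇔_; mk⇔)
open import Relation.Binary.PropositionalEquality using (_≡_; _≗_; refl; sym; cong; cong₂; module ≡-Reasoning)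
open import Relation.Nullary.Decidable using (does)
open import Data.Bool.Base using (if_then_else_)

open Algebra.Properties.Semiring.Sum ℤ.+-*-semiring using (sum-syntax; sum⁺-syntax; sum-cong-≗)

IsPartition : ℕ → List ℕ → Set
IsPartition n xs = Linked _≥_ xs × All (1 ≤_) xs × sum xs ≡ n

-- The weakly decreasing lists of at most ℓ positive integers, each at most k.

box : (ℓ k : ℕ) → List (List ℕ)
box zero    _       = [] ∷ []
box (suc ℓ) zero    = [] ∷ []
box (suc ℓ) (suc k) = map (suc k ∷_) (box ℓ (suc k)) ++ box (suc ℓ) k

partitions : ℕ → List (List ℕ)
partitions n = filter (λ xs → sum xs ≟ n) (box n n)

-- `partitions n` lists every partition of n exactly once (∈-partitions and
-- partitions-unique below).

InBox : (ℓ k : ℕ) → List ℕ → Set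
InBox ℓ k xs = Linked _≥_ xs × All (1 ≤_) xs × length xs ≤ ℓ × All (_≤ k) xs

private
  cons : ∀ {ℓ k xs} → InBox ℓ (suc k) xs → InBox (suc ℓ) (suc k) (suc k ∷ xs)
  cons {xs = []}    (_ , ps , l , bs)     = [-] , s≤s z≤n ∷ ps , s≤s l , ≤-refl ∷ bs
  cons {xs = _ ∷ _} (d , ps , l , b ∷ bs) = b ∷ d , s≤s z≤n ∷ ps , s≤s l , ≤-refl ∷ b ∷ bs

  tail-decreasing : ∀ {x xs} → Linked _≥_ (x ∷ xs) → Linked _≥_ xs
  tail-decreasing [-]     = []
  tail-decreasing (_ ∷ d) = d

  head-bounds : ∀ {k x xs} → Linked _≥_ (x ∷ xs) → x ≤ k → All (_≤ k) (x ∷ xs)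
  head-bounds [-]     b = b ∷ []
  head-bounds (r ∷ d) b = b ∷ head-bounds d (≤-trans r b)

box-sound : ∀ ℓ k {xs} → xs ∈ box ℓ k → InBox ℓ k xs
box-sound zero    _       (here refl) = [] , [] , z≤n , []
box-sound (suc ℓ) zero    (here refl) = [] , [] , z≤n , []
box-sound (suc ℓ) (suc k) xs∈ with ∈-++⁻ (map (suc k ∷_) (box ℓ (suc k))) xs∈
... | inj₁ p with _ , q , refl ← ∈-map⁻ (suc k ∷_) p = cons (box-sound ℓ (suc k) q)
... | inj₂ p with d , ps , l , bs ← box-sound (suc ℓ) k p = d , ps , l , All.map m≤n⇒m≤1+n bs

box-complete : ∀ ℓ k {xs} → InBox ℓ k xs → xs ∈ box ℓ k
box-complete zero    _       {[]}     _ = here refl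
box-complete zero    _       {_ ∷ _} (_ , _ , () , _)
box-complete (suc ℓ) zero    {[]}     _ = here refl
box-complete (suc ℓ) zero    {_ ∷ _} (_ , s≤s _ ∷ _ , _ , () ∷ _)
box-complete (suc ℓ) (suc k) {[]}     _ =
  ∈-++⁺ʳ (map (suc k ∷_) (box ℓ (suc k))) (box-complete (suc ℓ) k ([] , [] , z≤n , []))
box-complete (suc ℓ) (suc k) {x ∷ xs} (d , p ∷ ps , s≤s l , b ∷ bs) with m≤n⇒m<n∨m≡n b
... | inj₁ x<1+k =
  ∈-++⁺ʳ (map (suc k ∷_) (box ℓ (suc k)))
    (box-complete (suc ℓ) k (d , p ∷ ps , s≤s l , head-bounds d (m<1+n⇒m≤n x<1+k)))
... | inj₂ refl =
  ∈-++⁺ˡ (∈-map⁺ (suc k ∷_) (box-complete ℓ (suc k) (tail-decreasing d , ps , l , bs)))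

box-unique : ∀ ℓ k → Unique (box ℓ k)
box-unique zero    _       = [] ∷ []
box-unique (suc ℓ) zero    = [] ∷ []
box-unique (suc ℓ) (suc k) =
  Unique.++⁺ (Unique.map⁺ ∷-injectiveʳ (box-unique ℓ (suc k))) (box-unique (suc ℓ) k) disjoint
  where
  disjoint : Disjoint (map (suc k ∷_) (box ℓ (suc k))) (box (suc ℓ) k)
  disjoint (p , q) with _ , _ , refl ← ∈-map⁻ (suc k ∷_) p
                   with _ , _ , _ , b ∷ _ ← box-sound (suc ℓ) k q = n≮n k b

private
  length≤sum : ∀ {xs} → All (1 ≤_) xs → length xs ≤ sum xs
  length≤sum []       = z≤n
  length≤sum (p ∷ ps) = +-mono-≤ p (length≤sum ps)

  parts≤sum : ∀ xs → All (_≤ sum xs) xs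
  parts≤sum []       = []
  parts≤sum (x ∷ xs) =
    m≤m+n x (sum xs) ∷ All.map (λ b → ≤-trans b (m≤n+m (sum xs) x)) (parts≤sum xs)

∈-partitions : ∀ n {xs} → xs ∈ partitions n ⇔ IsPartition n xs
∈-partitions n = mk⇔ to from
  where
  to : ∀ {xs} → xs ∈ partitions n → IsPartition n xs
  to xs∈ with p , s ← ∈-filter⁻ (λ xs → sum xs ≟ n) {xs = box n n} xs∈
         with d , ps , _ ← box-sound n n p = d , ps , s

  from : ∀ {xs} → IsPartition n xs → xs ∈ partitions n
  from {xs} (d , ps , refl) =
    ∈-filter⁺ (λ ys → sum ys ≟ n) (box-complete n n (d , ps , length≤sum ps , parts≤sum xs)) refl

partitions-unique : ∀ n → Unique (partitions n)
partitions-unique n = Unique.filter⁺ (λ xs → sum xs ≟ n) (box-unique n n)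

ω : List ℕ → ℕ
ω xs = length (filter (_≟ 1) xs)

μ : List ℕ → ℕ
μ xs = length (filter (ω xs <?_) xs)

-- The value at the empty list is a placeholder: M below only uses crank on
-- partitions of n > 1.

crank : List ℕ → ℤ
crank []           = 0ℤ
crank xs@(x₁ ∷ _) with ω xs
... | zero      = + x₁
... | w@(suc _) = μ xs ⊖ w

M₀ : ℤ → ℤ
M₀ (+ 0) = 1ℤ
M₀ _     = 0ℤ

M₁ : ℤ → ℤ
M₁ (+ 0)    = -1ℤ
M₁ (+ 1)    = 1ℤ
M₁ -[1+ 0 ] = 1ℤ
M₁ _        = 0ℤ

M : ℤ → ℕ → ℤ
M m 0               = M₀ m
M m 1               = M₁ m
M m n@(suc (suc _)) = + length (filter (λ xs → crank xs ℤ.≟ m) (partitions n))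

-- f N is the coefficient of q^N; thus M m : FPS is Σ_{n ≥ 0} M(m,n) q^n.

FPS : Set
FPS = ℕ → ℤ

infix  8 q^_
infixl 7 _⊛_ _⊘_
infixl 6 _⊝_
infix  4 _SumsTo_

q^_ : ℕ → FPS
(q^ k) N = if does (N ≟ k) then 1ℤ else 0ℤ

𝟙 : FPS
𝟙 = q^ 0

_⊝_ : FPS → FPS → FPS
(f ⊝ g) N = f N ℤ.- g N

_⊛_ : FPS → FPS → FPS
(f ⊛ g) N = ∑[ i ≤ N ] (f (toℕ i) ℤ.* g (N ∸ toℕ i))

-- The reciprocal g of a series f with constant coefficient 1 is given by
-- g₀ = 1 and g_{N+1} = - Σ_{i ≤ N} f_{i+1} g_{N-i}; recipCoeffs f N is the
-- vector g_N, …, g_0.  For other f the value is meaningless.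

recipCoeffs : FPS → ∀ N → Vec ℤ (suc N)
recipCoeffs f zero    = 1ℤ Vec.∷ Vec.[]
recipCoeffs f (suc N) = ℤ.- (∑[ i ≤ N ] (f (suc (toℕ i)) ℤ.* lookup gs i)) Vec.∷ gs
  where gs = recipCoeffs f N

recip : FPS → FPS
recip f N = Vec.head (recipCoeffs f N)

_⊘_ : FPS → FPS → FPS
f ⊘ g = f ⊛ recip g

private
  lookup-recipCoeffs : ∀ f N (i : Fin (suc N)) → lookup (recipCoeffs f N) i ≡ recip f (N ∸ toℕ i)
  lookup-recipCoeffs f zero    zero    = refl
  lookup-recipCoeffs f (suc N) zero    = refl
  lookup-recipCoeffs f (suc N) (suc i) = lookup-recipCoeffs f N i

⊛-recip : ∀ f → f 0 ≡ 1ℤ → f ⊛ recip f ≗ 𝟙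
⊛-recip f f₀ zero    = cong (λ a → a ℤ.* 1ℤ ℤ.+ 0ℤ) f₀
⊛-recip f f₀ (suc N) = begin
  f 0 ℤ.* ℤ.- s ℤ.+ t   ≡⟨ cong (λ a → a ℤ.* ℤ.- s ℤ.+ t) f₀ ⟩
  1ℤ ℤ.* ℤ.- s ℤ.+ t    ≡⟨ cong (ℤ._+ t) (ℤ.*-identityˡ (ℤ.- s)) ⟩
  ℤ.- s ℤ.+ t           ≡⟨ cong (λ a → ℤ.- s ℤ.+ a) (sum-cong-≗ {suc N} (λ i → cong (f (suc (toℕ i)) ℤ.*_) (sym (lookup-recipCoeffs f N i)))) ⟩
  ℤ.- s ℤ.+ s           ≡⟨ ℤ.+-inverseˡ s ⟩
  0ℤ                    ∎
  where
  open ≡-Reasoning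
  s = ∑[ i ≤ N ] (f (suc (toℕ i)) ℤ.* lookup (recipCoeffs f N) i)
  t = ∑[ i ≤ N ] (f (suc (toℕ i)) ℤ.* recip f (N ∸ toℕ i))

-- poch a n is (a;q)_n, where a may itself be any power series in q.

poch : FPS → ℕ → FPS
poch a zero    = 𝟙
poch a (suc n) = poch a n ⊛ (𝟙 ⊝ a ⊛ q^ n)

poch-constant : ∀ n → poch (q^ 1) n 0 ≡ 1ℤ
poch-constant zero    = refl
poch-constant (suc n) = cong (λ a → a ℤ.* 1ℤ ℤ.+ 0ℤ) (poch-constant n)

denominator-constant : ∀ m n → (poch (q^ 1) m ⊛ poch (q^ 1) n) 0 ≡ 1ℤ
denominator-constant m n =
  cong₂ (λ a b → a ℤ.* b ℤ.+ 0ℤ) (poch-constant m) (poch-constant n)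

-- Σ_{i ≥ 0} F i converges to S in the q-adic topology: each coefficient of
-- the partial sums is eventually equal to that of S.

_SumsTo_ : (ℕ → FPS) → FPS → Set
F SumsTo S = ∀ N → ∃[ K ] ∀ k → K ≤ k → ∑[ i < k ] F (toℕ i) N ≡ S N

{-# OPTIONS --safe #-}
module Submission where

-- A partition with w > 0 ones has crank m iff it has w + m parts greater than w, and
-- these partitions are counted by crankTerm m w = (1 − q) q^(w + (w + m)(w + 1)) / ((q)_w (q)_{w + m}).
-- At w = 0 the same formula reads q^m (1 − q) / (q)_m: for m ≥ 2 it counts the
-- partitions without ones and with largest part m, and for m = 0, 1 it produces the
-- conventional values of M at n = 0, 1.  So Σ_n M(m, n) q^n = Σ_w crankTerm m w for m ≥ 0.
-- With term j n the n-th summand on the right and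
-- boundary j n = q^((n + 1)(n + j)) (1 − q^n) / ((q)_n (q)_{n + j}),
--   term j n − term (j + 1) n − crankTerm j n = boundary j n − boundary j (n + 1).
-- Since boundary j 0 = 0, summing over n shows that consecutive right-hand sides
-- differ by Σ_n M(j, n) q^n, and the right-hand side for j is divisible by q^j.

open import Defs
open import Algebra.Bundles using (CommutativeRing)
import Algebra.Properties.Semiring.Sum
import Algebra.Solver.Ring
open import Algebra.Solver.Ring.AlmostCommutativeRing using (fromCommutativeRing; _-Raw-AlmostCommutative⟶_)
open import Algebra.Structures using (IsCommutativeRing)
open import Data.Bool.Base using (true; false; if_then_else_)
open import Data.Fin.Base using (toℕ)
open import Data.Integer.Base as ℤ using (ℤ; +_; -[1+_]; 0ℤ; 1ℤ)
import Data.Integer.Properties as ℤ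
open import Data.Integer.Solver using () renaming (module +-*-Solver to ℤSolver)
open import Data.List.Base using (List; []; _∷_; _++_; map; length; filter)
open import Data.List.Membership.Propositional using (_∈_)
open import Data.List.Properties using (length-filter; filter-accept; filter-reject; filter-none)
open import Data.List.Relation.Unary.All as All using (All; []; _∷_)
open import Data.List.Relation.Unary.Any using (here; there)
open import Data.Maybe.Base using (Maybe; just; nothing)
open import Data.Nat.Base using (ℕ; zero; suc; _+_; _*_; _∸_; _≤_; _<_; z≤n; s≤s)
open import Data.Nat.ListAction using () renaming (sum to sumℕ)
import Data.Nat.Properties as ℕ
open import Data.Nat.Solver using () renaming (module +-*-Solver to ℕSolver)
open import Data.Product.Base using (_×_; _,_; ∃-syntax)
open import Function.Base using (_∘_)
open import Function.Bundles using (_⇔_; mk⇔)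
open import Level using (0ℓ)
open import Relation.Binary.PropositionalEquality
import Relation.Binary.Reasoning.Setoid as SetoidReasoning
open import Relation.Nullary using (¬_)
open import Relation.Nullary.Decidable using (Dec; does; yes; no; dec-true; dec-false; does-⇔)

open Algebra.Properties.Semiring.Sum ℤ.+-*-semiring using (sum-syntax)

-- Power series

-- A record rather than _≗_, so that f and g can be inferred.
infix 4 _≈_
record _≈_ (f g : FPS) : Set where
  constructor pointwise
  field at : f ≗ g
open _≈_

+-congˡ : ∀ a {b c} → b ≡ c → a ℤ.+ b ≡ a ℤ.+ c
+-congˡ a = cong (λ x → a ℤ.+ x)

sum-cong : ∀ n {f g : ℕ → ℤ} → (∀ i → i < n → f i ≡ g i) → ∑[ i < n ] f (toℕ i) ≡ ∑[ i < n ] g (toℕ i)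
sum-cong zero    eq = refl
sum-cong (suc n) eq = cong₂ ℤ._+_ (eq 0 (s≤s z≤n)) (sum-cong n (λ i i<n → eq (suc i) (s≤s i<n)))

sum-zero : ∀ n {f : ℕ → ℤ} → (∀ i → i < n → f i ≡ 0ℤ) → ∑[ i < n ] f (toℕ i) ≡ 0ℤ
sum-zero zero    eq = refl
sum-zero (suc n) eq = cong₂ ℤ._+_ (eq 0 (s≤s z≤n)) (sum-zero n (λ i i<n → eq (suc i) (s≤s i<n)))

infixl 7 _⊗_
infixl 6 _⊕_ _⊟_
infixr 7 _·_

-- Without opacity the type checker compares series by unfolding convolutions.
opaque
  _⊗_ : FPS → FPS → FPS
  _⊗_ = _⊛_

  _⊕_ : FPS → FPS → FPS
  (f ⊕ g) N = f N ℤ.+ g N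

  ⊖_ : FPS → FPS
  (⊖ f) N = ℤ.- f N

  𝟘 : FPS
  𝟘 _ = 0ℤ

  _·_ : ℤ → FPS → FPS
  (c · f) N = c ℤ.* f N

  -- By computation, `(f ⊗ g) (suc N)` is `f 0 ℤ.* g (suc N) ℤ.+ (tail f ⊗ g) N`. The inductions on
  -- N for the laws of `⊗` rest on this recursion instead of on reindexing sums.
  tail : FPS → FPS
  tail f N = f (suc N)

  ⊗-local : ∀ {f f′ g g′} N → (∀ i → i ≤ N → f i ≡ f′ i) → (∀ i → i ≤ N → g i ≡ g′ i) →
            (f ⊗ g) N ≡ (f′ ⊗ g′) N
  ⊗-local N p q = sum-cong (suc N) λ i i<1+N →
    cong₂ ℤ._*_ (p i (ℕ.m<1+n⇒m≤n i<1+N)) (q (N ∸ i) (ℕ.m∸n≤m N i))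

  ⊗-cong : ∀ {f f′ g g′} → f ≈ f′ → g ≈ g′ → f ⊗ g ≈ f′ ⊗ g′
  ⊗-cong p q = pointwise λ N → ⊗-local N (λ i _ → at p i) (λ i _ → at q i)

  ⊗-distribʳ-⊕ : ∀ h f g → (f ⊕ g) ⊗ h ≈ f ⊗ h ⊕ g ⊗ h
  ⊗-distribʳ-⊕ h f g = pointwise λ N → go N f g
    where
    open ℤSolver
    go : ∀ N f g → ((f ⊕ g) ⊗ h) N ≡ (f ⊗ h) N ℤ.+ (g ⊗ h) N
    go zero    f g = solve 3 (λ a b c → (a :+ b) :* c :+ con 0ℤ := (a :* c :+ con 0ℤ) :+ (b :* c :+ con 0ℤ)) refl (f 0) (g 0) (h 0)
    go (suc N) f g = trans (+-congˡ ((f 0 ℤ.+ g 0) ℤ.* h (suc N)) (go N (tail f) (tail g)))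
      (solve 5 (λ a b c d e → (a :+ b) :* c :+ (d :+ e) := (a :* c :+ d) :+ (b :* c :+ e)) refl
        (f 0) (g 0) (h (suc N)) ((tail f ⊗ h) N) ((tail g ⊗ h) N))

  ·-⊗ : ∀ c f g → (c · f) ⊗ g ≈ c · (f ⊗ g)
  ·-⊗ c f g = pointwise λ N → go N f
    where
    open ℤSolver
    go : ∀ N f → ((c · f) ⊗ g) N ≡ c ℤ.* (f ⊗ g) N
    go zero    f = solve 3 (λ c a b → (c :* a) :* b :+ con 0ℤ := c :* (a :* b :+ con 0ℤ)) refl c (f 0) (g 0)
    go (suc N) f = trans (+-congˡ (c ℤ.* f 0 ℤ.* g (suc N)) (go N (tail f)))
      (solve 4 (λ c a b d → c :* a :* b :+ c :* d := c :* (a :* b :+ d)) refl c (f 0) (g (suc N)) ((tail f ⊗ g) N))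

  ⊗-assoc : ∀ f g h → (f ⊗ g) ⊗ h ≈ f ⊗ (g ⊗ h)
  ⊗-assoc f g h = pointwise λ N → go N f
    where
    open ℤSolver
    go : ∀ N f → ((f ⊗ g) ⊗ h) N ≡ (f ⊗ (g ⊗ h)) N
    go zero    f = solve 3 (λ a b c → (a :* b :+ con 0ℤ) :* c :+ con 0ℤ := a :* (b :* c :+ con 0ℤ) :+ con 0ℤ) refl (f 0) (g 0) (h 0)
    go (suc N) f = begin
      -- `tail (f ⊗ g)` unfolds to `f 0 · tail g ⊕ tail f ⊗ g`, so distributivity and the induction
      -- hypothesis for `tail f` apply.
      (f 0 ℤ.* g 0 ℤ.+ 0ℤ) ℤ.* h (suc N) ℤ.+ ((f 0 · tail g ⊕ tail f ⊗ g) ⊗ h) N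
        ≡⟨ +-congˡ ((f 0 ℤ.* g 0 ℤ.+ 0ℤ) ℤ.* h (suc N)) (trans (at (⊗-distribʳ-⊕ h (f 0 · tail g) (tail f ⊗ g)) N)
             (cong₂ ℤ._+_ (at (·-⊗ (f 0) (tail g) h) N) (go N (tail f)))) ⟩
      (f 0 ℤ.* g 0 ℤ.+ 0ℤ) ℤ.* h (suc N) ℤ.+ (f 0 ℤ.* (tail g ⊗ h) N ℤ.+ (tail f ⊗ (g ⊗ h)) N)
        ≡⟨ solve 5 (λ a b c d e → (a :* b :+ con 0ℤ) :* c :+ (a :* d :+ e) := a :* (b :* c :+ d) :+ e) refl
             (f 0) (g 0) (h (suc N)) ((tail g ⊗ h) N) ((tail f ⊗ (g ⊗ h)) N) ⟩
      f 0 ℤ.* (g ⊗ h) (suc N) ℤ.+ (tail f ⊗ (g ⊗ h)) N ∎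
      where open ≡-Reasoning

  ⊗-comm : ∀ f g → f ⊗ g ≈ g ⊗ f
  ⊗-comm f g = pointwise λ N → go N f g
    where
    open ℤSolver
    go : ∀ N f g → (f ⊗ g) N ≡ (g ⊗ f) N
    go zero          f g = cong (ℤ._+ 0ℤ) (ℤ.*-comm (f 0) (g 0))
    go (suc zero)    f g = solve 4 (λ a b c d → a :* d :+ (b :* c :+ con 0ℤ) := c :* b :+ (d :* a :+ con 0ℤ)) refl
      (f 0) (f 1) (g 0) (g 1)
    -- Peeling one coefficient off each factor leaves `tail f ⊗ tail g` at N, which is symmetric by
    -- induction. The descent by two is why N = 1 is a separate case.
    go (suc (suc N)) f g = begin
      f 0 ℤ.* g (2 + N) ℤ.+ (tail f ⊗ g) (suc N)  ≡⟨ +-congˡ (f 0 ℤ.* g (2 + N)) (go (suc N) (tail f) g) ⟩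
      f 0 ℤ.* g (2 + N) ℤ.+ (g 0 ℤ.* f (2 + N) ℤ.+ (tail g ⊗ tail f) N)
        ≡⟨ cong (λ x → f 0 ℤ.* g (2 + N) ℤ.+ (g 0 ℤ.* f (2 + N) ℤ.+ x)) (go N (tail g) (tail f)) ⟩
      f 0 ℤ.* g (2 + N) ℤ.+ (g 0 ℤ.* f (2 + N) ℤ.+ (tail f ⊗ tail g) N)
        ≡⟨ solve 3 (λ a b c → a :+ (b :+ c) := b :+ (a :+ c)) refl (f 0 ℤ.* g (2 + N)) (g 0 ℤ.* f (2 + N)) ((tail f ⊗ tail g) N) ⟩
      g 0 ℤ.* f (2 + N) ℤ.+ (f 0 ℤ.* g (2 + N) ℤ.+ (tail f ⊗ tail g) N)
        ≡⟨ +-congˡ (g 0 ℤ.* f (2 + N)) (go (suc N) f (tail g)) ⟩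
      g 0 ℤ.* f (2 + N) ℤ.+ (tail g ⊗ f) (suc N)  ∎
      where open ≡-Reasoning

  𝟘-⊗ : ∀ f → 𝟘 ⊗ f ≈ 𝟘
  𝟘-⊗ f = pointwise λ N → sum-zero (suc N) (λ i _ → ℤ.*-zeroˡ (f (N ∸ i)))

  q^0⊗ : ∀ f → 𝟙 ⊗ f ≈ f
  q^0⊗ f = pointwise λ where
    zero    → trans (ℤ.+-identityʳ _) (ℤ.*-identityˡ (f 0))
    (suc N) → trans (cong₂ ℤ._+_ (ℤ.*-identityˡ (f (suc N))) (at (𝟘-⊗ f) N)) (ℤ.+-identityʳ _)

  FPS-isCommutativeRing : IsCommutativeRing _≈_ _⊕_ _⊗_ ⊖_ 𝟘 𝟙
  FPS-isCommutativeRing = record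
    { isRing = record
      { +-isAbelianGroup = record
        { isGroup = record
          { isMonoid = record
            { isSemigroup = record
              { isMagma = record
                { isEquivalence = record
                  { refl  = pointwise λ _ → refl
                  ; sym   = λ p → pointwise λ N → sym (at p N)
                  ; trans = λ p q → pointwise λ N → trans (at p N) (at q N) }
                ; ∙-cong = λ p q → pointwise λ N → cong₂ ℤ._+_ (at p N) (at q N) }
              ; assoc = λ f g h → pointwise λ N → ℤ.+-assoc (f N) (g N) (h N) }
            ; identity = (λ f → pointwise λ N → ℤ.+-identityˡ (f N)) , (λ f → pointwise λ N → ℤ.+-identityʳ (f N)) }
          ; inverse = (λ f → pointwise λ N → ℤ.+-inverseˡ (f N)) , (λ f → pointwise λ N → ℤ.+-inverseʳ (f N))
          ; ⁻¹-cong = λ p → pointwise λ N → cong ℤ.-_ (at p N) }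
        ; comm = λ f g → pointwise λ N → ℤ.+-comm (f N) (g N) }
      ; *-cong = ⊗-cong
      ; *-assoc = ⊗-assoc
      ; *-identity = q^0⊗ , λ f → ≈-trans (⊗-comm f 𝟙) (q^0⊗ f)
      ; distrib = (λ f g h → ≈-trans (⊗-comm f (g ⊕ h)) (≈-trans (⊗-distribʳ-⊕ f g h)
                      (pointwise λ N → cong₂ ℤ._+_ (at (⊗-comm g f) N) (at (⊗-comm h f) N))))
                , ⊗-distribʳ-⊕ }
    ; *-comm = ⊗-comm }
    where
    ≈-trans : ∀ {f g h} → f ≈ g → g ≈ h → f ≈ h
    ≈-trans p q = pointwise λ N → trans (at p N) (at q N)

FPS-ring : CommutativeRing 0ℓ 0ℓ
FPS-ring = record { isCommutativeRing = FPS-isCommutativeRing }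

module FPS = CommutativeRing FPS-ring
module ≈-Reasoning = SetoidReasoning FPS.setoid

_⊟_ : FPS → FPS → FPS
f ⊟ g = f ⊕ ⊖ g

-- The clause for 1 makes con 1ℤ in the solver denote 𝟙 definitionally.
constant : ℤ → FPS
constant (+ 1) = 𝟙
constant c     = c · 𝟙

opaque
  unfolding _⊗_

  constant-· : ∀ c → constant c ≈ c · 𝟙
  constant-· (+ 0)           = FPS.refl
  constant-· (+ 1)           = pointwise λ N → sym (ℤ.*-identityˡ (𝟙 N))
  constant-· (+ suc (suc n)) = FPS.refl
  constant-· -[1+ n ]        = FPS.refl

  constant-+ : ∀ a b → constant (a ℤ.+ b) ≈ constant a ⊕ constant b
  constant-+ a b = FPS.trans (constant-· (a ℤ.+ b)) (FPS.trans
    (pointwise λ N → ℤ.*-distribʳ-+ (𝟙 N) a b)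
    (FPS.sym (FPS.+-cong (constant-· a) (constant-· b))))

  constant-* : ∀ a b → constant (a ℤ.* b) ≈ constant a ⊗ constant b
  constant-* a b = FPS.trans (constant-· (a ℤ.* b)) (FPS.trans
    (FPS.sym (FPS.trans (·-⊗ a 𝟙 (b · 𝟙))
      (pointwise λ N → trans (cong (a ℤ.*_) (at (q^0⊗ (b · 𝟙)) N)) (sym (ℤ.*-assoc a b (𝟙 N))))))
    (FPS.sym (FPS.*-cong (constant-· a) (constant-· b))))

  constant-neg : ∀ a → constant (ℤ.- a) ≈ ⊖ constant a
  constant-neg a = FPS.trans (constant-· (ℤ.- a)) (FPS.trans
    (pointwise λ N → sym (ℤ.neg-distribˡ-* a (𝟙 N)))
    (FPS.sym (FPS.-‿cong (constant-· a))))

  constant-0 : constant 0ℤ ≈ 𝟘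
  constant-0 = pointwise λ N → ℤ.*-zeroˡ (𝟙 N)

constant-morphism : ℤ.+-*-rawRing -Raw-AlmostCommutative⟶ fromCommutativeRing FPS-ring
constant-morphism = record
  { ⟦_⟧    = constant
  ; +-homo = constant-+
  ; *-homo = constant-*
  ; -‿homo = constant-neg
  ; 0-homo = constant-0
  ; 1-homo = FPS.refl
  }

coefficient-≟ : ∀ a b → Maybe (constant a ≈ constant b)
coefficient-≟ a b with a ℤ.≟ b
... | yes refl = just FPS.refl
... | no  _    = nothing

module FPSSolver = Algebra.Solver.Ring ℤ.+-*-rawRing (fromCommutativeRing FPS-ring) constant-morphism coefficient-≟

-- Pochhammer quotients

opaque
  unfolding _⊗_

  ⊗-0 : ∀ f g → (f ⊗ g) 0 ≡ f 0 ℤ.* g 0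
  ⊗-0 f g = ℤ.+-identityʳ _

  -- The tail of `q^ suc a` reduces to `q^ a`, and its constant coefficient is 0. With `q^-suc-⊗-0`
  -- this gives multiplication by a power of q as an iterated shift.
  q^-suc-⊗-suc : ∀ a f N → (q^ suc a ⊗ f) (suc N) ≡ (q^ a ⊗ f) N
  q^-suc-⊗-suc a f N = trans (cong (ℤ._+ (q^ a ⊗ f) N) (ℤ.*-zeroˡ (f (suc N)))) (ℤ.+-identityˡ _)

  ⊕-at : ∀ f g N → (f ⊕ g) N ≡ f N ℤ.+ g N
  ⊕-at f g N = refl

  ⊟-at : ∀ f g N → (f ⊟ g) N ≡ f N ℤ.- g N
  ⊟-at f g N = refl

  ·-at : ∀ c f N → (c · f) N ≡ c ℤ.* f N
  ·-at c f N = refl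

  𝟘-at : ∀ N → 𝟘 N ≡ 0ℤ
  𝟘-at N = refl

  ⊛≈⊗ : ∀ f g → f ⊛ g ≈ f ⊗ g
  ⊛≈⊗ f g = FPS.refl

  poch-step : ∀ a n → poch a (suc n) ≈ poch a n ⊗ (𝟙 ⊟ a ⊗ q^ n)
  poch-step a n = FPS.refl

q^-suc-⊗-0 : ∀ a f → (q^ suc a ⊗ f) 0 ≡ 0ℤ
q^-suc-⊗-0 a f = trans (⊗-0 (q^ suc a) f) (ℤ.*-zeroˡ (f 0))

q^-+ : ∀ a b → q^ (a + b) ≈ q^ a ⊗ q^ b
q^-+ a b = pointwise (go a)
  where
  go : ∀ a N → (q^ (a + b)) N ≡ (q^ a ⊗ q^ b) N
  go zero    N       = sym (at (q^0⊗ (q^ b)) N)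
  go (suc a) zero    = sym (q^-suc-⊗-0 a (q^ b))
  go (suc a) (suc N) = trans (go a N) (sym (q^-suc-⊗-suc a (q^ b) N))

q^-suc : ∀ a → q^ suc a ≈ q^ 1 ⊗ q^ a
q^-suc = q^-+ 1

-- Congruence modulo powers of q

infix 4 _≈[_]_

-- Congruence modulo q^k. Counting in a box is correct only in low degrees, so the generating
-- functions of boxes are identified up to this relation.
record _≈[_]_ (f : FPS) (k : ℕ) (g : FPS) : Set where
  constructor below
  field at< : ∀ N → N < k → f N ≡ g N
open _≈[_]_

≈⇒≈[] : ∀ {f g k} → f ≈ g → f ≈[ k ] g
≈⇒≈[] p = below λ N _ → at p N

≈[]-refl : ∀ {f k} → f ≈[ k ] f
≈[]-refl = below λ _ _ → refl

≈[]-trans : ∀ {f g h k} → f ≈[ k ] g → g ≈[ k ] h → f ≈[ k ] h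
≈[]-trans p q = below λ N N<k → trans (at< p N N<k) (at< q N N<k)

opaque
  unfolding _⊗_

  ⊗-cong-[] : ∀ {f f′ g g′ k} → f ≈[ k ] f′ → g ≈[ k ] g′ → f ⊗ g ≈[ k ] f′ ⊗ g′
  ⊗-cong-[] p q = below λ N N<k →
    ⊗-local N (λ i i≤N → at< p i (ℕ.≤-<-trans i≤N N<k)) (λ i i≤N → at< q i (ℕ.≤-<-trans i≤N N<k))

q^⊗-cong-[] : ∀ a {f g k} → f ≈[ k ] g → q^ a ⊗ f ≈[ a + k ] q^ a ⊗ g
q^⊗-cong-[] zero    p = ⊗-cong-[] ≈[]-refl p
q^⊗-cong-[] (suc a) {f} {g} p = below λ where
  zero    _         → trans (q^-suc-⊗-0 a f) (sym (q^-suc-⊗-0 a g))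
  (suc N) (s≤s N<k) → trans (q^-suc-⊗-suc a f N) (trans (at< (q^⊗-cong-[] a p) N N<k) (sym (q^-suc-⊗-suc a g N)))

q^⊗-vanishes : ∀ a f → q^ a ⊗ f ≈[ a ] 𝟘
-- Modulo q^0 every series is congruent to `𝟘`; the factor q^a raises the modulus to a.
q^⊗-vanishes a f = below λ N N<a → trans (at< (q^⊗-cong-[] a {f} {𝟘} {0} (below λ _ ())) N (subst (N <_) (sym (ℕ.+-identityʳ a)) N<a))
  (at (FPS.zeroʳ (q^ a)) N)

⊗-recip : ∀ f → f 0 ≡ 1ℤ → f ⊗ recip f ≈ 𝟙
⊗-recip f f₀ = FPS.trans (FPS.sym (⊛≈⊗ f (recip f))) (pointwise (⊛-recip f f₀))

-- Both sides equal f g h. Identities between reciprocals are obtained from this uniqueness, without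
-- unfolding the recurrence that defines `recip`.
inverse-unique : ∀ f {g h} → f ⊗ g ≈ 𝟙 → f ⊗ h ≈ 𝟙 → g ≈ h
inverse-unique f {g} {h} p q = begin
  g            ≈⟨ FPS.*-identityˡ g ⟨
  𝟙 ⊗ g        ≈⟨ FPS.*-congʳ q ⟨
  f ⊗ h ⊗ g    ≈⟨ FPSSolver.solve 3 (λ f g h → f FPSSolver.:* h FPSSolver.:* g FPSSolver.:= f FPSSolver.:* g FPSSolver.:* h) FPS.refl f g h ⟩
  f ⊗ g ⊗ h    ≈⟨ FPS.*-congʳ p ⟩
  𝟙 ⊗ h        ≈⟨ FPS.*-identityˡ h ⟩
  h            ∎
  where open ≈-Reasoning

recip-⊛ : ∀ f g → f 0 ≡ 1ℤ → g 0 ≡ 1ℤ → recip (f ⊛ g) ≈ recip f ⊗ recip g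
recip-⊛ f g f₀ g₀ = inverse-unique (f ⊛ g) (⊗-recip (f ⊛ g) (cong₂ (λ a b → a ℤ.* b ℤ.+ 0ℤ) f₀ g₀)) (begin
  (f ⊛ g) ⊗ (recip f ⊗ recip g)        ≈⟨ FPS.*-congʳ (⊛≈⊗ f g) ⟩
  f ⊗ g ⊗ (recip f ⊗ recip g)          ≈⟨ FPSSolver.solve 4 (λ a b c d → a FPSSolver.:* b FPSSolver.:* (c FPSSolver.:* d) FPSSolver.:= (a FPSSolver.:* c) FPSSolver.:* (b FPSSolver.:* d)) FPS.refl f g (recip f) (recip g) ⟩
  (f ⊗ recip f) ⊗ (g ⊗ recip g)        ≈⟨ FPS.*-cong (⊗-recip f f₀) (⊗-recip g g₀) ⟩
  𝟙 ⊗ 𝟙                                ≈⟨ FPS.*-identityˡ 𝟙 ⟩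
  𝟙                                    ∎)
  where open ≈-Reasoning

opaque
  R : ℕ → FPS
  R n = recip (poch (q^ 1) n)

  poch-R : ∀ n → poch (q^ 1) n ⊗ R n ≈ 𝟙
  poch-R n = ⊗-recip (poch (q^ 1) n) (poch-constant n)

  R-at-0 : ∀ n → R n 0 ≡ 1ℤ
  R-at-0 n = refl

opaque
  unfolding R

  recip-poch-⊛ : ∀ m n → recip (poch (q^ 1) m ⊛ poch (q^ 1) n) ≈ R m ⊗ R n
  recip-poch-⊛ m n = recip-⊛ (poch (q^ 1) m) (poch (q^ 1) n) (poch-constant m) (poch-constant n)

-- Since (q)_{n+1} = (q)_n (1 - q^(n+1)), the right-hand side is also an inverse of (q)_n. Rewriting
-- `R n` through `R (suc n)` brings sums over a common denominator, so that the ring solver can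
-- finish.
R-suc : ∀ n → R n ≈ R (suc n) ⊗ (𝟙 ⊟ q^ 1 ⊗ q^ n)
R-suc n = inverse-unique p (poch-R n) (begin
  p ⊗ (R (suc n) ⊗ c)    ≈⟨ FPSSolver.solve 3 (λ p r c → p FPSSolver.:* (r FPSSolver.:* c) FPSSolver.:= p FPSSolver.:* c FPSSolver.:* r) FPS.refl p (R (suc n)) c ⟩
  p ⊗ c ⊗ R (suc n)      ≈⟨ FPS.*-congʳ (poch-step (q^ 1) n) ⟨
  poch (q^ 1) (suc n) ⊗ R (suc n)  ≈⟨ poch-R (suc n) ⟩
  𝟙                      ∎)
  where
  open ≈-Reasoning
  p = poch (q^ 1) n
  c = 𝟙 ⊟ q^ 1 ⊗ q^ n

R-0 : R 0 ≈ 𝟙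
R-0 = inverse-unique 𝟙 (poch-R 0) (FPS.*-identityˡ 𝟙)

-- Multiplying `R k` by 1 - q, for k ≥ 1, removes the factor that generates ones: `C ⊗ R k` counts
-- partitions into parts from 2 to k.
C : FPS
C = 𝟙 ⊟ q^ 1

⊟-cong : ∀ {f f′ g g′} → f ≈ f′ → g ≈ g′ → f ⊟ g ≈ f′ ⊟ g′
⊟-cong p q = FPS.+-cong p (FPS.-‿cong q)

R-1 : C ⊗ R 1 ≈ 𝟙
R-1 = begin
  C ⊗ R 1                      ≈⟨ FPS.*-comm C (R 1) ⟩
  R 1 ⊗ C                      ≈⟨ FPS.*-congˡ (⊟-cong FPS.refl (FPS.sym (FPS.*-identityʳ (q^ 1)))) ⟩
  R 1 ⊗ (𝟙 ⊟ q^ 1 ⊗ q^ 0)      ≈⟨ R-suc 0 ⟨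
  R 0                          ≈⟨ R-0 ⟩
  𝟙                            ∎
  where open ≈-Reasoning

-- `poch` grows at its last factor; here the first one is split off. The induction works because q^r
-- q^(b+1) = q^(r+1) q^b.
poch-suc : ∀ r b → poch (q^ r) (suc b) ≈ (𝟙 ⊟ q^ r) ⊗ poch (q^ suc r) b
poch-suc r zero = begin
  poch (q^ r) 1       ≈⟨ poch-step (q^ r) 0 ⟩
  𝟙 ⊗ (𝟙 ⊟ q^ r ⊗ 𝟙)  ≈⟨ FPS.*-comm _ _ ⟩
  (𝟙 ⊟ q^ r ⊗ 𝟙) ⊗ 𝟙  ≈⟨ FPS.*-congʳ (⊟-cong FPS.refl (FPS.*-identityʳ (q^ r))) ⟩
  (𝟙 ⊟ q^ r) ⊗ 𝟙      ∎
  where open ≈-Reasoning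
poch-suc r (suc b) = begin
  poch (q^ r) (suc (suc b))
    ≈⟨ poch-step (q^ r) (suc b) ⟩
  poch (q^ r) (suc b) ⊗ (𝟙 ⊟ q^ r ⊗ q^ suc b)
    ≈⟨ FPS.*-cong (poch-suc r b) (⊟-cong FPS.refl shift) ⟩
  (𝟙 ⊟ q^ r) ⊗ poch (q^ suc r) b ⊗ (𝟙 ⊟ q^ suc r ⊗ q^ b)
    ≈⟨ FPS.*-assoc _ _ _ ⟩
  (𝟙 ⊟ q^ r) ⊗ (poch (q^ suc r) b ⊗ (𝟙 ⊟ q^ suc r ⊗ q^ b))
    ≈⟨ FPS.*-congˡ (poch-step (q^ suc r) b) ⟨
  (𝟙 ⊟ q^ r) ⊗ poch (q^ suc r) (suc b)  ∎
  where
  open ≈-Reasoning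
  shift : q^ r ⊗ q^ suc b ≈ q^ suc r ⊗ q^ b
  shift = begin
    q^ r ⊗ q^ suc b     ≈⟨ q^-+ r (suc b) ⟨
    q^ (r + suc b)      ≡⟨ cong q^_ (ℕ.+-suc r b) ⟩
    q^ (suc r + b)      ≈⟨ q^-+ (suc r) b ⟩
    q^ suc r ⊗ q^ b     ∎

-- Each factor 1 - q^(r+i) is 1 modulo q^r.
poch-limit : ∀ r b → poch (q^ r) b ≈[ r ] 𝟙
poch-limit r zero    = ≈[]-refl
poch-limit r (suc b) = ≈[]-trans (≈⇒≈[] (poch-step (q^ r) b)) (≈[]-trans (⊗-cong-[] (poch-limit r b) factor) (≈⇒≈[] (FPS.*-identityˡ 𝟙)))
  where
  factor : 𝟙 ⊟ q^ r ⊗ q^ b ≈[ r ] 𝟙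
  factor = below λ N N<r → trans (⊟-at 𝟙 (q^ r ⊗ q^ b) N)
    (trans (cong (λ x → 𝟙 N ℤ.- x) (trans (at< (q^⊗-vanishes r (q^ b)) N N<r) (𝟘-at N))) (ℤ.+-identityʳ (𝟙 N)))

-- For k ≥ 1, U k a counts the partitions into parts ≤ k with a ones.
U : ℕ → ℕ → FPS
U k a = q^ a ⊗ (C ⊗ R k)

U-1 : ∀ a → U 1 a ≈ q^ a
U-1 a = FPS.trans (FPS.*-congˡ R-1) (FPS.*-identityʳ (q^ a))

-- For k ≥ 1 a partition into parts ≤ k + 1 either has no part k + 1 or loses one such part, which
-- is not a one. This matches the recursion of `box`.
U-suc : ∀ k a → U (suc k) a ≈ U k a ⊕ q^ suc k ⊗ U (suc k) a
U-suc k a = begin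
  q^ a ⊗ (C ⊗ s)
    ≈⟨ FPSSolver.solve 5 (λ a c s q x → a :* (c :* s) := a :* (c :* (s :* (con 1ℤ :- q :* x))) :+ q :* x :* (a :* (c :* s)))
         FPS.refl (q^ a) C s (q^ 1) (q^ k) ⟩
  q^ a ⊗ (C ⊗ (s ⊗ (𝟙 ⊟ q^ 1 ⊗ q^ k))) ⊕ q^ 1 ⊗ q^ k ⊗ (q^ a ⊗ (C ⊗ s))
    ≈⟨ FPS.+-cong (FPS.*-congˡ (FPS.*-congˡ (FPS.sym (R-suc k)))) (FPS.*-congʳ (FPS.sym (q^-suc k))) ⟩
  q^ a ⊗ (C ⊗ R k) ⊕ q^ suc k ⊗ (q^ a ⊗ (C ⊗ s)) ∎
  where
  open ≈-Reasoning
  open FPSSolver using (_:*_; _:+_; _:-_; _:=_; con)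
  s = R (suc k)

-- For w ≥ 1, V w r b counts the partitions into parts ≤ w + r with w ones and b parts > w.
V : (w r b : ℕ) → FPS
V w r b = U w w ⊗ (q^ (b * suc w) ⊗ (poch (q^ r) b ⊗ R b))

V-0 : ∀ w r → V w r 0 ≈ U w w
V-0 w r = begin
  U w w ⊗ (𝟙 ⊗ (𝟙 ⊗ R 0))  ≈⟨ FPS.*-congˡ (FPS.trans (FPS.*-identityˡ _) (FPS.trans (FPS.*-identityˡ _) R-0)) ⟩
  U w w ⊗ 𝟙                ≈⟨ FPS.*-identityʳ _ ⟩
  U w w                    ∎
  where open ≈-Reasoning

V-00 : ∀ w b → V w 0 (suc b) ≈ 𝟘
V-00 w b = begin
  u ⊗ (e ⊗ (poch (q^ 0) (suc b) ⊗ s))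
    ≈⟨ FPS.*-congˡ (FPS.*-congˡ (FPS.*-congʳ (poch-suc 0 b))) ⟩
  u ⊗ (e ⊗ ((𝟙 ⊟ 𝟙) ⊗ p ⊗ s))
    ≈⟨ FPSSolver.solve 4 (λ u e p s → u :* (e :* ((con 1ℤ :- con 1ℤ) :* p :* s)) := con 0ℤ) FPS.refl u e p s ⟩
  constant 0ℤ
    ≈⟨ constant-0 ⟩
  𝟘 ∎
  where
  open ≈-Reasoning
  open FPSSolver using (_:*_; _:+_; _:-_; _:=_; con)
  u = U w w
  e = q^ (suc b * suc w)
  p = poch (q^ 1) b
  s = R (suc b)

-- For r ≥ 1 the quotient (q^r)_b / (q)_b is a Gaussian binomial coefficient; with q^(b(w+1)) it
-- counts multisets of b sizes among w + 1, ..., w + r. The identity is the q-Pascal rule: the size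
-- w + r + 1 is absent, or one copy of it is removed.
V-suc : ∀ w r b → V w (suc r) (suc b) ≈ V w r (suc b) ⊕ q^ suc (w + r) ⊗ V w (suc r) b
V-suc w r b = begin
  u ⊗ (e′ ⊗ (poch (q^ suc r) (suc b) ⊗ s))
    ≈⟨ FPS.*-congˡ (FPS.*-congˡ (FPS.*-congʳ (poch-step (q^ suc r) b))) ⟩
  u ⊗ (e′ ⊗ (p ⊗ (𝟙 ⊟ q^ suc r ⊗ x) ⊗ s))
    ≈⟨ FPS.*-congˡ (FPS.*-congˡ (FPS.*-congʳ (FPS.*-congˡ (⊟-cong FPS.refl (FPS.*-congʳ (q^-suc r)))))) ⟩
  u ⊗ (e′ ⊗ (p ⊗ (𝟙 ⊟ q^ 1 ⊗ y ⊗ x) ⊗ s))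
    ≈⟨ FPS.*-congˡ (FPS.*-congʳ e′≈) ⟩
  u ⊗ (d ⊗ e ⊗ (p ⊗ (𝟙 ⊟ q^ 1 ⊗ y ⊗ x) ⊗ s))
    -- The split is 1 - q^(r+1+b) = (1 - q^r) + q^r (1 - q^(b+1)). The first summand extends `p`
    -- downwards to (q^r)_{b+1}; the second cancels the last factor of (q)_{b+1}.
    ≈⟨ FPSSolver.solve 8 (λ u d e p q x y s →
         u :* (d :* e :* (p :* (con 1ℤ :- q :* y :* x) :* s)) :=
         u :* (d :* e :* ((con 1ℤ :- y) :* p :* s)) :+ d :* y :* (u :* (e :* (p :* (s :* (con 1ℤ :- q :* x))))))
         FPS.refl u d e p (q^ 1) x y s ⟩
  u ⊗ (d ⊗ e ⊗ ((𝟙 ⊟ y) ⊗ p ⊗ s)) ⊕ d ⊗ y ⊗ (u ⊗ (e ⊗ (p ⊗ (s ⊗ (𝟙 ⊟ q^ 1 ⊗ x)))))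
    ≈⟨ FPS.+-cong (FPS.*-congˡ (FPS.*-cong (FPS.sym e′≈) (FPS.*-congʳ (FPS.sym (poch-suc r b)))))
         (FPS.*-cong (FPS.sym (q^-+ (suc w) r)) (FPS.*-congˡ (FPS.*-congˡ (FPS.*-congˡ (FPS.sym (R-suc b)))))) ⟩
  V w r (suc b) ⊕ q^ suc (w + r) ⊗ V w (suc r) b ∎
  where
  open ≈-Reasoning
  open FPSSolver using (_:*_; _:+_; _:-_; _:=_; con)
  u  = U w w
  e  = q^ (b * suc w)
  e′ = q^ (suc b * suc w)
  d  = q^ suc w
  p  = poch (q^ suc r) b
  x  = q^ b
  y  = q^ r
  s  = R (suc b)
  e′≈ : e′ ≈ d ⊗ e
  e′≈ = q^-+ (suc w) (b * suc w)

crankTerm : (m w : ℕ) → FPS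
crankTerm m w = q^ (w + (w + m) * suc w) ⊗ (C ⊗ (R w ⊗ R (w + m)))

-- The bound w + r on the parts enters only through (q^r)_b, which is 1 modulo q^r. The power of q
-- in front adds its exponent to that modulus.
V-limit : ∀ w r m → V w r (w + m) ≈[ w + (w + m) * suc w + r ] crankTerm m w
V-limit w r m =
  ≈[]-trans (≈⇒≈[] (begin
    q^ w ⊗ (C ⊗ R w) ⊗ (q^ e ⊗ (p ⊗ R b))
      ≈⟨ FPSSolver.solve 6 (λ x c s y p t → x :* (c :* s) :* (y :* (p :* t)) := x :* y :* (p :* (c :* (s :* t))))
           FPS.refl (q^ w) C (R w) (q^ e) p (R b) ⟩
    q^ w ⊗ q^ e ⊗ (p ⊗ t)
      ≈⟨ FPS.*-congʳ (FPS.sym (q^-+ w e)) ⟩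
    q^ (w + e) ⊗ (p ⊗ t) ∎))
  (≈[]-trans (q^⊗-cong-[] (w + e) (⊗-cong-[] (poch-limit r b) ≈[]-refl))
    (≈⇒≈[] (FPS.*-congˡ (FPS.*-identityˡ t))))
  where
  open ≈-Reasoning
  open FPSSolver using (_:*_; _:=_)
  b = w + m
  e = b * suc w
  p = poch (q^ r) b
  t = C ⊗ (R w ⊗ R b)

-- Telescoping

term : (j n : ℕ) → FPS
term j n = q^ ((n + 1) * (n + j)) ⊗ (R n ⊗ R (n + j))

⊘≈term : ∀ j n → q^ ((n + 1) * (n + j)) ⊘ (poch (q^ 1) n ⊛ poch (q^ 1) (n + j)) ≈ term j n
⊘≈term j n = FPS.trans (⊛≈⊗ (q^ ((n + 1) * (n + j))) (recip (poch (q^ 1) n ⊛ poch (q^ 1) (n + j))))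
  (FPS.*-congˡ (recip-poch-⊛ n (n + j)))

boundary : (j n : ℕ) → FPS
boundary j n = q^ ((n + 1) * (n + j)) ⊗ ((𝟙 ⊟ q^ n) ⊗ (R n ⊗ R (n + j)))

boundary-0 : ∀ j → boundary j 0 ≈ 𝟘
boundary-0 j = FPS.trans
  (FPSSolver.solve 2 (λ e t → e :* ((con 1ℤ :- con 1ℤ) :* t) := con 0ℤ) FPS.refl (q^ (1 * j)) (R 0 ⊗ R j))
  constant-0
  where open FPSSolver using (_:*_; _:-_; _:=_; con)

-- After division by the common factor q^((n+1)(n+j)) / ((q)_n (q)_{n+j+1}), with x = q^n and y =
-- q^(n+j), this becomes (1 - qy) + q²xy = qx + x(1 - q)(1 - qy) + (1 - x)(1 - qy).
telescope : ∀ j n → term j n ⊕ boundary j (suc n) ≈ term (suc j) n ⊕ crankTerm j n ⊕ boundary j n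
telescope j n = begin
  term j n ⊕ boundary j (suc n)
    ≈⟨ FPS.+-cong (FPS.*-congˡ (FPS.*-congˡ (R-suc (n + j)))) boundary≈ ⟩
  e ⊗ (r ⊗ (s ⊗ d)) ⊕ e ⊗ (q ⊗ q ⊗ x ⊗ y) ⊗ (r ⊗ s)
    ≈⟨ FPSSolver.solve 6 (λ e q x y r s →
         e :* (r :* (s :* (con 1ℤ :- q :* y))) :+ e :* (q :* q :* x :* y) :* (r :* s) :=
         e :* (q :* x) :* (r :* s)
           :+ x :* e :* ((con 1ℤ :- q) :* (r :* (s :* (con 1ℤ :- q :* y))))
           :+ e :* ((con 1ℤ :- x) :* (r :* (s :* (con 1ℤ :- q :* y)))))
         FPS.refl e q x y r s ⟩
  e ⊗ (q ⊗ x) ⊗ (r ⊗ s) ⊕ x ⊗ e ⊗ (C ⊗ (r ⊗ (s ⊗ d))) ⊕ e ⊗ ((𝟙 ⊟ x) ⊗ (r ⊗ (s ⊗ d)))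
    ≈⟨ FPS.+-cong (FPS.+-cong (FPS.sym term≈) (FPS.sym crankTerm≈)) (FPS.*-congˡ (FPS.*-congˡ (FPS.*-congˡ (FPS.sym (R-suc (n + j)))))) ⟩
  term (suc j) n ⊕ crankTerm j n ⊕ boundary j n ∎
  where
  open ≈-Reasoning
  open FPSSolver using (_:*_; _:+_; _:-_; _:=_; con)
  e = q^ ((n + 1) * (n + j))
  q = q^ 1
  x = q^ n
  y = q^ (n + j)
  r = R n
  s = R (suc (n + j))
  d = 𝟙 ⊟ q ⊗ y

  term≈ : term (suc j) n ≈ e ⊗ (q ⊗ x) ⊗ (r ⊗ s)
  term≈ = begin
    term (suc j) n
      ≡⟨ cong₂ (λ a b → q^ a ⊗ (r ⊗ R b))
           (solve 2 (λ n j → (n :+: k1) :*: (n :+: (k1 :+: j)) :=: (n :+: k1) :*: (n :+: j) :+: (k1 :+: n)) refl n j)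
           (ℕ.+-suc n j) ⟩
    q^ ((n + 1) * (n + j) + suc n) ⊗ (r ⊗ s)
      ≈⟨ FPS.*-congʳ (FPS.trans (q^-+ ((n + 1) * (n + j)) (suc n)) (FPS.*-congˡ (q^-suc n))) ⟩
    e ⊗ (q ⊗ x) ⊗ (r ⊗ s) ∎
    where
    open ℕSolver using (solve) renaming (_:+_ to _:+:_; _:*_ to _:*:_; _:=_ to _:=:_; con to k)
    k1 : ∀ {n} → ℕSolver.Polynomial n
    k1 = k 1

  crankTerm≈ : crankTerm j n ≈ x ⊗ e ⊗ (C ⊗ (r ⊗ (s ⊗ d)))
  crankTerm≈ = FPS.*-cong
    (FPS.trans (q^-+ n ((n + j) * suc n)) (FPS.*-congˡ (FPS.reflexive (cong q^_
      (trans (ℕ.*-comm (n + j) (suc n)) (cong (_* (n + j)) (ℕ.+-comm 1 n)))))))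
    (FPS.*-congˡ (FPS.*-congˡ (R-suc (n + j))))

  -- The factor 1 - q^(n+1) turns `R (suc n)` into `R n`, and the exponent grows by 2 + n + (n + j).
  boundary≈ : boundary j (suc n) ≈ e ⊗ (q ⊗ q ⊗ x ⊗ y) ⊗ (r ⊗ s)
  boundary≈ = begin
    q^ ((suc n + 1) * (suc n + j)) ⊗ ((𝟙 ⊟ q^ suc n) ⊗ (R (suc n) ⊗ s))
      ≡⟨ cong (λ a → q^ a ⊗ ((𝟙 ⊟ q^ suc n) ⊗ (R (suc n) ⊗ s)))
           (solve 2 (λ n j → (k1 :+: n :+: k1) :*: (k1 :+: n :+: j) :=:
                             (n :+: k1) :*: (n :+: j) :+: (k1 :+: k1 :+: n :+: (n :+: j))) refl n j) ⟩
    q^ ((n + 1) * (n + j) + (1 + 1 + n + (n + j))) ⊗ ((𝟙 ⊟ q^ suc n) ⊗ (R (suc n) ⊗ s))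
      ≈⟨ FPS.*-cong
           (FPS.trans (q^-+ ((n + 1) * (n + j)) (1 + 1 + n + (n + j))) (FPS.*-congˡ
             (FPS.trans (q^-+ (1 + 1 + n) (n + j)) (FPS.*-congʳ (FPS.trans (q^-+ 2 n) (FPS.*-congʳ (q^-+ 1 1)))))))
           (FPS.trans (FPSSolver.solve 3 (λ a b c → a :* (b :* c) := b :* a :* c) FPS.refl (𝟙 ⊟ q^ suc n) (R (suc n)) s)
             (FPS.*-congʳ (FPS.trans (FPS.*-congˡ (⊟-cong FPS.refl (q^-suc n))) (FPS.sym (R-suc n))))) ⟩
    e ⊗ (q ⊗ q ⊗ x ⊗ y) ⊗ (r ⊗ s) ∎
    where
    open ℕSolver using (solve) renaming (_:+_ to _:+:_; _:*_ to _:*:_; _:=_ to _:=:_; con to k)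
    k1 : ∀ {n} → ℕSolver.Polynomial n
    k1 = k 1

sum-telescope : ∀ k {x y c g : ℕ → ℤ} → (∀ n → x n ℤ.+ g (suc n) ≡ y n ℤ.+ c n ℤ.+ g n) →
  ∑[ n < k ] x (toℕ n) ℤ.+ g k ≡ ∑[ n < k ] y (toℕ n) ℤ.+ ∑[ n < k ] c (toℕ n) ℤ.+ g 0
sum-telescope zero    eq = refl
sum-telescope (suc k) {x} {y} {c} {g} eq = begin
  x 0 ℤ.+ X ℤ.+ g (suc k)                ≡⟨ ℤ.+-assoc (x 0) X (g (suc k)) ⟩
  x 0 ℤ.+ (X ℤ.+ g (suc k))              ≡⟨ +-congˡ (x 0) (sum-telescope k {λ n → x (suc n)} {λ n → y (suc n)} {λ n → c (suc n)} {λ n → g (suc n)} (λ n → eq (suc n))) ⟩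
  x 0 ℤ.+ (Y ℤ.+ Z ℤ.+ g 1)              ≡⟨ solve 4 (λ a b c d → a :+ (b :+ c :+ d) := (a :+ d) :+ (b :+ c)) refl (x 0) Y Z (g 1) ⟩
  x 0 ℤ.+ g 1 ℤ.+ (Y ℤ.+ Z)              ≡⟨ cong (ℤ._+ (Y ℤ.+ Z)) (eq 0) ⟩
  y 0 ℤ.+ c 0 ℤ.+ g 0 ℤ.+ (Y ℤ.+ Z)      ≡⟨ solve 5 (λ a b c d e → a :+ b :+ c :+ (d :+ e) := (a :+ d) :+ (b :+ e) :+ c) refl (y 0) (c 0) (g 0) Y Z ⟩
  (y 0 ℤ.+ Y) ℤ.+ (c 0 ℤ.+ Z) ℤ.+ g 0    ∎
  where
  open ≡-Reasoning
  open ℤSolver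
  X = ∑[ n < k ] x (suc (toℕ n))
  Y = ∑[ n < k ] y (suc (toℕ n))
  Z = ∑[ n < k ] c (suc (toℕ n))

sum-truncate : ∀ {K k} {f : ℕ → ℤ} → (∀ i → K ≤ i → f i ≡ 0ℤ) → K ≤ k →
               ∑[ i < k ] f (toℕ i) ≡ ∑[ i < K ] f (toℕ i)
sum-truncate {k = k} eq z≤n        = sum-zero k (λ i _ → eq i z≤n)
sum-truncate {f = f} eq (s≤s K≤k) = +-congˡ (f 0) (sum-truncate (λ i K≤i → eq (suc i) (s≤s K≤i)) K≤k)

n+j≤exponent : ∀ n j → n + j ≤ (n + 1) * (n + j)
n+j≤exponent n j = subst (λ a → n + j ≤ a * (n + j)) (ℕ.+-comm 1 n) (ℕ.m≤m+n (n + j) (n * (n + j)))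

q^⊗-at : ∀ {a} f {N} → N < a → (q^ a ⊗ f) N ≡ 0ℤ
q^⊗-at {a} f {N} N<a = trans (at< (q^⊗-vanishes a f) N N<a) (𝟘-at N)

-- The sum may stop at n = N because `term j n` has order at least n + j.
durfeeSum : ℕ → FPS
durfeeSum j N = ∑[ n < suc N ] term j (toℕ n) N

term-at : ∀ j n {N} → N < n + j → term j n N ≡ 0ℤ
term-at j n N<n+j = q^⊗-at _ (ℕ.<-≤-trans N<n+j (n+j≤exponent n j))

durfeeSum-at : ∀ j {N} → N < j → durfeeSum j N ≡ 0ℤ
durfeeSum-at j {N} N<j = sum-zero (suc N) (λ n _ → term-at j n (ℕ.<-≤-trans N<j (ℕ.m≤n+m j n)))

term-sums : ∀ j → term j SumsTo durfeeSum j
term-sums j N = suc N , λ k → sum-truncate (λ n N<n → term-at j n (ℕ.<-≤-trans N<n (ℕ.m≤m+n n j)))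

durfeeSum-suc : ∀ j N → durfeeSum j N ≡ ∑[ w < suc N ] crankTerm j (toℕ w) N ℤ.+ durfeeSum (suc j) N
durfeeSum-suc j N = begin
  durfeeSum j N                       ≡⟨ ℤ.+-identityʳ _ ⟨
  -- The upper boundary term has order at least N + 1 + j, so its coefficient at N is 0.
  durfeeSum j N ℤ.+ 0ℤ                ≡⟨ cong (λ a → durfeeSum j N ℤ.+ a) (q^⊗-at _ (ℕ.<-≤-trans (ℕ.m≤m+n (suc N) j) (n+j≤exponent (suc N) j))) ⟨
  durfeeSum j N ℤ.+ boundary j (suc N) N
    ≡⟨ sum-telescope (suc N) {λ n → term j n N} {λ n → term (suc j) n N} {λ n → crankTerm j n N} {λ n → boundary j n N} step ⟩
  durfeeSum (suc j) N ℤ.+ c ℤ.+ boundary j 0 N  ≡⟨ cong (λ a → durfeeSum (suc j) N ℤ.+ c ℤ.+ a) (trans (at (boundary-0 j) N) (𝟘-at N)) ⟩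
  durfeeSum (suc j) N ℤ.+ c ℤ.+ 0ℤ    ≡⟨ ℤ.+-identityʳ _ ⟩
  durfeeSum (suc j) N ℤ.+ c           ≡⟨ ℤ.+-comm (durfeeSum (suc j) N) c ⟩
  c ℤ.+ durfeeSum (suc j) N           ∎
  where
  open ≡-Reasoning
  c = ∑[ w < suc N ] crankTerm j (toℕ w) N
  step : ∀ n → term j n N ℤ.+ boundary j (suc n) N ≡ term (suc j) n N ℤ.+ crankTerm j n N ℤ.+ boundary j n N
  step n = begin
    term j n N ℤ.+ boundary j (suc n) N                          ≡⟨ ⊕-at (term j n) (boundary j (suc n)) N ⟨
    (term j n ⊕ boundary j (suc n)) N                            ≡⟨ at (telescope j n) N ⟩
    (term (suc j) n ⊕ crankTerm j n ⊕ boundary j n) N            ≡⟨ ⊕-at (term (suc j) n ⊕ crankTerm j n) (boundary j n) N ⟩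
    (term (suc j) n ⊕ crankTerm j n) N ℤ.+ boundary j n N        ≡⟨ cong (ℤ._+ boundary j n N) (⊕-at (term (suc j) n) (crankTerm j n) N) ⟩
    term (suc j) n N ℤ.+ crankTerm j n N ℤ.+ boundary j n N      ∎

-- Generating functions of partitions

indicator : ∀ {P : Set} → Dec P → ℤ
indicator P? = if does P? then 1ℤ else 0ℤ

indicator-yes : ∀ {P : Set} (P? : Dec P) → P → indicator P? ≡ 1ℤ
indicator-yes P? p = cong (if_then 1ℤ else 0ℤ) (dec-true P? p)

indicator-no : ∀ {P : Set} (P? : Dec P) → ¬ P → indicator P? ≡ 0ℤ
indicator-no P? ¬p = cong (if_then 1ℤ else 0ℤ) (dec-false P? ¬p)

δ : ℕ → ℕ → ℤ
δ a b = indicator (a ℕ.≟ b)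

-- Conditions on partitions are encoded as integer weights, so that the crank condition can be split
-- additively into cases.
gf : (List ℕ → ℤ) → List (List ℕ) → FPS
gf φ []       N = 0ℤ
gf φ (xs ∷ L) N = φ xs ℤ.* (q^ sumℕ xs) N ℤ.+ gf φ L N

gf-cong : ∀ {φ ψ} L {N} → (∀ {xs} → xs ∈ L → sumℕ xs ≡ N → φ xs ≡ ψ xs) → gf φ L N ≡ gf ψ L N
gf-cong             []       eq = refl
gf-cong {φ} {ψ} (xs ∷ L) {N} eq = cong₂ ℤ._+_ head (gf-cong L (eq ∘ there))
  where
  head : φ xs ℤ.* (q^ sumℕ xs) N ≡ ψ xs ℤ.* (q^ sumℕ xs) N
  head with N ℕ.≟ sumℕ xs
  ... | yes N≡ = cong (ℤ._* (q^ sumℕ xs) N) (eq (here refl) (sym N≡))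
  ... | no  N≢ = trans (cong (φ xs ℤ.*_) q≡0) (trans (ℤ.*-zeroʳ (φ xs)) (sym (trans (cong (ψ xs ℤ.*_) q≡0) (ℤ.*-zeroʳ (ψ xs)))))
    where
    q≡0 : (q^ sumℕ xs) N ≡ 0ℤ
    q≡0 = indicator-no (N ℕ.≟ sumℕ xs) N≢

gf-zero : ∀ {φ} L {N} → (∀ {xs} → xs ∈ L → sumℕ xs ≡ N → φ xs ≡ 0ℤ) → gf φ L N ≡ 0ℤ
gf-zero {φ} L {N} eq = trans (gf-cong L eq) (go L)
  where
  go : ∀ L → gf (λ _ → 0ℤ) L N ≡ 0ℤ
  go []       = refl
  go (xs ∷ L) = cong₂ ℤ._+_ (ℤ.*-zeroˡ ((q^ sumℕ xs) N)) (go L)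

gf-+ : ∀ φ ψ L N → gf (λ xs → φ xs ℤ.+ ψ xs) L N ≡ gf φ L N ℤ.+ gf ψ L N
gf-+ φ ψ []       N = refl
gf-+ φ ψ (xs ∷ L) N = trans (+-congˡ ((φ xs ℤ.+ ψ xs) ℤ.* (q^ sumℕ xs) N) (gf-+ φ ψ L N))
  (solve 5 (λ a b q c d → (a :+ b) :* q :+ (c :+ d) := (a :* q :+ c) :+ (b :* q :+ d)) refl
    (φ xs) (ψ xs) ((q^ sumℕ xs) N) (gf φ L N) (gf ψ L N))
  where open ℤSolver

gf-∑ : ∀ K (φ : ℕ → List ℕ → ℤ) L N →
       gf (λ xs → ∑[ i < K ] φ (toℕ i) xs) L N ≡ ∑[ i < K ] gf (φ (toℕ i)) L N
gf-∑ zero    φ L N = gf-zero L (λ _ _ → refl)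
gf-∑ (suc K) φ L N = trans (gf-+ (φ 0) (λ xs → ∑[ i < K ] φ (suc (toℕ i)) xs) L N)
  (+-congˡ (gf (φ 0) L N) (gf-∑ K (φ ∘ suc) L N))

gf-++ : ∀ φ L L′ N → gf φ (L ++ L′) N ≡ gf φ L N ℤ.+ gf φ L′ N
gf-++ φ []       L′ N = sym (ℤ.+-identityˡ _)
gf-++ φ (xs ∷ L) L′ N = trans (+-congˡ (φ xs ℤ.* (q^ sumℕ xs) N) (gf-++ φ L L′ N)) (sym (ℤ.+-assoc (φ xs ℤ.* (q^ sumℕ xs) N) _ _))

-- With L = `box n n` the inner filter is `partitions n`, so this converts the count in `M` into a
-- coefficient of `gf`.
gf-filter : ∀ {P : List ℕ → Set} (P? : ∀ xs → Dec (P xs)) L n →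
            + length (filter P? (filter (λ xs → sumℕ xs ℕ.≟ n) L)) ≡ gf (indicator ∘ P?) L n
gf-filter P? []       n = refl
gf-filter P? (xs ∷ L) n with sumℕ xs ℕ.≟ n
... | no  s≢n = begin
  + length (filter P? (filter sum≟ (xs ∷ L)))     ≡⟨ cong (λ l → + length (filter P? l)) (filter-reject sum≟ {x = xs} {xs = L} s≢n) ⟩
  + length (filter P? (filter sum≟ L))            ≡⟨ gf-filter P? L n ⟩
  rest                                            ≡⟨ ℤ.+-identityˡ rest ⟨
  0ℤ ℤ.+ rest                                     ≡⟨ cong (ℤ._+ rest) (ℤ.*-zeroʳ c) ⟨
  c ℤ.* 0ℤ ℤ.+ rest                               ≡⟨ cong (λ a → c ℤ.* a ℤ.+ rest) (indicator-no (n ℕ.≟ sumℕ xs) (s≢n ∘ sym)) ⟨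
  c ℤ.* (q^ sumℕ xs) n ℤ.+ rest                   ∎
  where
  open ≡-Reasoning
  sum≟ = λ xs → sumℕ xs ℕ.≟ n
  rest = gf (indicator ∘ P?) L n
  c    = indicator (P? xs)
... | yes s≡n = begin
  + length (filter P? (filter sum≟ (xs ∷ L)))     ≡⟨ cong (λ l → + length (filter P? l)) (filter-accept sum≟ {x = xs} {xs = L} s≡n) ⟩
  + length (filter P? (xs ∷ filter sum≟ L))       ≡⟨ head ⟩
  c ℤ.+ rest                                      ≡⟨ cong (ℤ._+ rest) (ℤ.*-identityʳ c) ⟨
  c ℤ.* 1ℤ ℤ.+ rest                               ≡⟨ cong (λ a → c ℤ.* a ℤ.+ rest) (indicator-yes (n ℕ.≟ sumℕ xs) (sym s≡n)) ⟨
  c ℤ.* (q^ sumℕ xs) n ℤ.+ rest                   ∎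
  where
  open ≡-Reasoning
  sum≟ = λ xs → sumℕ xs ℕ.≟ n
  rest = gf (indicator ∘ P?) L n
  c    = indicator (P? xs)
  head : + length (filter P? (xs ∷ filter sum≟ L)) ≡ c ℤ.+ rest
  head with does (P? xs)
  ... | true  = +-congˡ 1ℤ (gf-filter P? L n)
  ... | false = trans (gf-filter P? L n) (sym (ℤ.+-identityˡ rest))

gf-∷ : ∀ φ xs L → gf φ (xs ∷ L) ≈ φ xs · q^ sumℕ xs ⊕ gf φ L
gf-∷ φ xs L = pointwise λ N → sym (trans (⊕-at (φ xs · q^ sumℕ xs) (gf φ L) N)
  (cong (ℤ._+ gf φ L N) (·-at (φ xs) (q^ sumℕ xs) N)))

gf-map : ∀ φ x L → gf φ (map (x ∷_) L) ≈ q^ x ⊗ gf (λ xs → φ (x ∷ xs)) L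
gf-map φ x []       = FPS.sym (FPS.trans (FPS.*-congˡ (pointwise λ N → sym (𝟘-at N))) (FPS.trans (FPS.zeroʳ (q^ x)) (pointwise 𝟘-at)))
gf-map φ x (xs ∷ L) = begin
  gf φ ((x ∷ xs) ∷ map (x ∷_) L)                                   ≈⟨ gf-∷ φ (x ∷ xs) (map (x ∷_) L) ⟩
  c · q^ (x + s) ⊕ gf φ (map (x ∷_) L)                             ≈⟨ FPS.+-cong scale (gf-map φ x L) ⟩
  q^ x ⊗ (c · q^ s) ⊕ q^ x ⊗ gf (λ ys → φ (x ∷ ys)) L              ≈⟨ FPS.distribˡ (q^ x) (c · q^ s) _ ⟨
  q^ x ⊗ (c · q^ s ⊕ gf (λ ys → φ (x ∷ ys)) L)                     ≈⟨ FPS.*-congˡ (gf-∷ (λ ys → φ (x ∷ ys)) xs L) ⟨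
  q^ x ⊗ gf (λ ys → φ (x ∷ ys)) (xs ∷ L)                           ∎
  where
  open ≈-Reasoning
  c = φ (x ∷ xs)
  s = sumℕ xs
  scale : c · q^ (x + s) ≈ q^ x ⊗ (c · q^ s)
  scale = begin
    c · q^ (x + s)         ≈⟨ pointwise (λ N → trans (·-at c (q^ (x + s)) N) (trans (cong (c ℤ.*_) (at (FPS.trans (q^-+ x s) (FPS.*-comm (q^ x) (q^ s))) N)) (sym (·-at c (q^ s ⊗ q^ x) N)))) ⟩
    c · (q^ s ⊗ q^ x)      ≈⟨ ·-⊗ c (q^ s) (q^ x) ⟨
    (c · q^ s) ⊗ q^ x      ≈⟨ FPS.*-comm (c · q^ s) (q^ x) ⟩
    q^ x ⊗ (c · q^ s)      ∎

≈[]-weaken : ∀ {f g k l} → l ≤ k → f ≈[ k ] g → f ≈[ l ] g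
≈[]-weaken l≤k p = below λ N N<l → at< p N (ℕ.<-≤-trans N<l l≤k)

⊕-cong-[] : ∀ {f f′ g g′ k} → f ≈[ k ] f′ → g ≈[ k ] g′ → f ⊕ g ≈[ k ] f′ ⊕ g′
⊕-cong-[] {f} {f′} {g} {g′} p q = below λ N N<k →
  trans (⊕-at f g N) (trans (cong₂ ℤ._+_ (at< p N N<k) (at< q N N<k)) (sym (⊕-at f′ g′ N)))

-- This follows the recursion of `box`. The hypothesis on lists with one part fewer is one degree
-- weaker; prepending k + 1 contributes q^(k+1), which gains at least that degree.
gf-box : ∀ {φ F G ℓ} k →
         gf (λ xs → φ (suc k ∷ xs)) (box ℓ (suc k)) ≈[ suc ℓ ] F →
         gf φ (box (suc ℓ) k) ≈[ suc (suc ℓ) ] G →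
         gf φ (box (suc ℓ) (suc k)) ≈[ suc (suc ℓ) ] q^ suc k ⊗ F ⊕ G
gf-box {φ} {F} {G} {ℓ} k p q = ≈[]-trans
  (≈⇒≈[] (FPS.trans
    (pointwise λ N → trans (gf-++ φ (map (suc k ∷_) (box ℓ (suc k))) (box (suc ℓ) k) N)
      (sym (⊕-at (gf φ (map (suc k ∷_) (box ℓ (suc k)))) (gf φ (box (suc ℓ) k)) N)))
    (FPS.+-congʳ (gf-map φ (suc k) (box ℓ (suc k))))))
  (⊕-cong-[] (≈[]-weaken (s≤s (ℕ.m≤n+m (suc ℓ) k)) (q^⊗-cong-[] (suc k) p)) q)

gf-vanishes : ∀ {φ} L {k} → (∀ {xs} → xs ∈ L → φ xs ≡ 0ℤ) → gf φ L ≈[ k ] 𝟘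
gf-vanishes L eq = below λ N _ → trans (gf-zero L (λ xs∈ _ → eq xs∈)) (sym (𝟘-at N))

gf-[[]] : ∀ φ → gf φ ([] ∷ []) ≈ φ [] · 𝟙
gf-[[]] φ = pointwise λ N → trans (ℤ.+-identityʳ _) (sym (·-at (φ []) 𝟙 N))

-- Partitions with prescribed numbers of ones and of large parts

U-at-0 : ∀ k a → U k a 0 ≡ δ 0 a
U-at-0 k a = begin
  U k a 0                          ≡⟨ ⊗-0 (q^ a) (C ⊗ R k) ⟩
  δ 0 a ℤ.* (C ⊗ R k) 0            ≡⟨ cong (δ 0 a ℤ.*_) (trans (⊗-0 C (R k)) (cong₂ ℤ._*_ (⊟-at 𝟙 (q^ 1) 0) (R-at-0 k))) ⟩
  δ 0 a ℤ.* 1ℤ                     ≡⟨ ℤ.*-identityʳ (δ 0 a) ⟩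
  δ 0 a                            ∎
  where open ≡-Reasoning

ones : ℕ → List ℕ → ℤ
ones a xs = δ (ω xs) a

-- Partitions of size at most ℓ have at most ℓ parts, hence the modulus q^(ℓ+1). The bound 1 on the
-- parts is treated apart, since only there does the prepended part change the number of ones.
ones-gf : ∀ ℓ k a → gf (ones a) (box ℓ (suc k)) ≈[ suc ℓ ] U (suc k) a
ones-gf zero k a = below λ where
  zero    _        → trans (ℤ.+-identityʳ _) (trans (ℤ.*-identityʳ (δ 0 a)) (sym (U-at-0 (suc k) a)))
  (suc _) (s≤s ())
ones-gf (suc ℓ) zero zero = ≈[]-trans
  (gf-box 0 (gf-vanishes (box ℓ 1) (λ _ → refl)) (≈⇒≈[] (gf-[[]] (ones 0))))
  (≈⇒≈[] (begin
    q^ 1 ⊗ 𝟘 ⊕ 1ℤ · 𝟙    ≈⟨ FPS.+-cong (FPS.zeroʳ (q^ 1)) (FPS.sym (constant-· 1ℤ)) ⟩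
    𝟘 ⊕ 𝟙                ≈⟨ FPS.+-identityˡ 𝟙 ⟩
    𝟙                    ≈⟨ U-1 0 ⟨
    U 1 0                ∎))
  where open ≈-Reasoning
ones-gf (suc ℓ) zero (suc a) = ≈[]-trans
  (gf-box 0 (ones-gf ℓ zero a) (≈⇒≈[] (gf-[[]] (ones (suc a)))))
  (≈⇒≈[] (begin
    q^ 1 ⊗ U 1 a ⊕ 0ℤ · 𝟙    ≈⟨ FPS.+-cong (FPS.*-congˡ (U-1 a)) constant-0 ⟩
    q^ 1 ⊗ q^ a ⊕ 𝟘          ≈⟨ FPS.+-identityʳ _ ⟩
    q^ 1 ⊗ q^ a              ≈⟨ q^-suc a ⟨
    q^ suc a                 ≈⟨ U-1 (suc a) ⟨
    U 1 (suc a)              ∎))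
  where open ≈-Reasoning
ones-gf (suc ℓ) (suc k) a = ≈[]-trans
  (gf-box (suc k) (ones-gf ℓ (suc k) a) (ones-gf (suc ℓ) k a))
  (≈⇒≈[] (FPS.trans (FPS.+-comm _ _) (FPS.sym (U-suc (suc k) a))))

-- `μ xs` is `large (ω xs) xs`. Freeing the threshold from `ω` keeps it fixed while parts are
-- prepended.
large : ℕ → List ℕ → ℕ
large w xs = length (filter (w ℕ.<?_) xs)

onesLarge : (w b : ℕ) → List ℕ → ℤ
onesLarge w b xs = ones w xs ℤ.* δ (large w xs) b

large-small : ∀ w {xs} → All (_≤ w) xs → large w xs ≡ 0
large-small w xs≤w = cong length (filter-none (w ℕ.<?_) (All.map ℕ.≤⇒≯ xs≤w))

-- `box` recurses as in `V-suc`, starting from the size bound w + 1, where no part is large. The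
-- bound is written `r + suc w` so that a successor in r exposes the one on which `box` recurses.
onesLarge-gf : ∀ w r b ℓ → gf (onesLarge (suc w) b) (box ℓ (r + suc w)) ≈[ suc ℓ ] V (suc w) r b
onesLarge-gf w zero zero ℓ = ≈[]-trans
  (below λ N _ → gf-cong (box ℓ (suc w)) (λ {xs} xs∈ _ → small xs xs∈))
  (≈[]-trans (ones-gf ℓ w (suc w)) (≈⇒≈[] (FPS.sym (V-0 (suc w) 0))))
  where
  small : ∀ xs → xs ∈ box ℓ (suc w) → onesLarge (suc w) 0 xs ≡ ones (suc w) xs
  small xs xs∈ with _ , _ , _ , xs≤ ← box-sound ℓ (suc w) xs∈ =
    trans (cong (λ n → ones (suc w) xs ℤ.* δ n 0) (large-small (suc w) xs≤)) (ℤ.*-identityʳ (ones (suc w) xs))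
onesLarge-gf w zero (suc b) ℓ = ≈[]-trans
  (gf-vanishes (box ℓ (suc w)) (λ {xs} → small xs))
  (≈⇒≈[] (FPS.sym (V-00 (suc w) b)))
  where
  small : ∀ xs → xs ∈ box ℓ (suc w) → onesLarge (suc w) (suc b) xs ≡ 0ℤ
  small xs xs∈ with _ , _ , _ , xs≤ ← box-sound ℓ (suc w) xs∈ =
    trans (cong (λ n → ones (suc w) xs ℤ.* δ n (suc b)) (large-small (suc w) xs≤)) (ℤ.*-zeroʳ (ones (suc w) xs))
onesLarge-gf w (suc r) b zero = below λ where
  zero    _        → sym (trans (⊗-0 (U (suc w) (suc w)) (q^ (b * suc (suc w)) ⊗ (poch (q^ suc r) b ⊗ R b)))
                       (cong (ℤ._* (q^ (b * suc (suc w)) ⊗ (poch (q^ suc r) b ⊗ R b)) 0) (U-at-0 (suc w) (suc w))))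
  (suc _) (s≤s ())
onesLarge-gf w (suc r) b (suc ℓ) = go b
  where
  step : ∀ xs → large (suc w) (suc (r + suc w) ∷ xs) ≡ suc (large (suc w) xs)
  step xs = cong length (filter-accept (suc w ℕ.<?_) (s≤s (ℕ.m≤n+m (suc w) r)))

  ω-step : ∀ xs → ω (suc (r + suc w) ∷ xs) ≡ ω xs
  -- The rewriting exposes two successors in the first part, which shows that it is not 1.
  ω-step xs rewrite ℕ.+-suc r w = refl

  ones-step : ∀ b xs → onesLarge (suc w) b (suc (r + suc w) ∷ xs) ≡ ones (suc w) xs ℤ.* δ (suc (large (suc w) xs)) b
  ones-step b xs = cong₂ (λ m n → δ m (suc w) ℤ.* δ n b) (ω-step xs) (step xs)

  open ≈-Reasoning
  go : ∀ b → gf (onesLarge (suc w) b) (box (suc ℓ) (suc (r + suc w))) ≈[ suc (suc ℓ) ] V (suc w) (suc r) b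
  go zero = ≈[]-trans
    (gf-box (r + suc w)
      (gf-vanishes (box ℓ (suc (r + suc w))) (λ {xs} _ → trans (ones-step 0 xs) (ℤ.*-zeroʳ (ones (suc w) xs))))
      (onesLarge-gf w r 0 (suc ℓ)))
    (≈⇒≈[] (begin
      q^ suc (r + suc w) ⊗ 𝟘 ⊕ V (suc w) r 0    ≈⟨ FPS.+-congʳ (FPS.zeroʳ _) ⟩
      𝟘 ⊕ V (suc w) r 0                         ≈⟨ FPS.+-identityˡ _ ⟩
      V (suc w) r 0                             ≈⟨ V-0 (suc w) r ⟩
      U (suc w) (suc w)                         ≈⟨ V-0 (suc w) (suc r) ⟨
      V (suc w) (suc r) 0                       ∎))
  go (suc b) = ≈[]-trans
    (gf-box (r + suc w)
      (≈[]-trans (below λ N _ → gf-cong (box ℓ (suc (r + suc w))) (λ {xs} _ _ → ones-step (suc b) xs))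
        (onesLarge-gf w (suc r) b ℓ))
      (onesLarge-gf w r (suc b) (suc ℓ)))
    (≈⇒≈[] (begin
      q^ suc (r + suc w) ⊗ V (suc w) (suc r) b ⊕ V (suc w) r (suc b)
        ≈⟨ FPS.+-comm _ _ ⟩
      V (suc w) r (suc b) ⊕ q^ suc (r + suc w) ⊗ V (suc w) (suc r) b
        ≡⟨ cong (λ a → V (suc w) r (suc b) ⊕ q^ suc a ⊗ V (suc w) (suc r) b) (ℕ.+-comm r (suc w)) ⟩
      V (suc w) r (suc b) ⊕ q^ suc (suc w + r) ⊗ V (suc w) (suc r) b
        ≈⟨ V-suc (suc w) r b ⟨
      V (suc w) (suc r) (suc b) ∎))

-- Partitions without ones, by largest part

largest : List ℕ → ℕ
largest []      = 0
largest (x ∷ _) = x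

noOnesLargest : ℕ → List ℕ → ℤ
noOnesLargest m xs = ones 0 xs ℤ.* δ (largest xs) m

largest-≤ : ∀ {k xs} → All (_≤ k) xs → largest xs ≤ k
largest-≤ []      = z≤n
largest-≤ (b ∷ _) = b

box-largest : ∀ ℓ k {xs} → xs ∈ box ℓ k → largest xs ≤ k
box-largest ℓ k xs∈ with _ , _ , _ , b ← box-sound ℓ k xs∈ = largest-≤ b

noOnesLargest-zero : ∀ {m} xs → largest xs ≢ m → noOnesLargest m xs ≡ 0ℤ
noOnesLargest-zero {m} xs ≢m = trans (cong (ones 0 xs ℤ.*_) (indicator-no (largest xs ℕ.≟ m) ≢m)) (ℤ.*-zeroʳ (ones 0 xs))

-- Here the factor q^(m+2) of `U` stands for the largest part m + 2, not for ones; the remaining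
-- parts lie between 2 and m + 2 and are counted by `C ⊗ R (2 + m)`. Sizes above m + 2 contribute
-- nothing as first part.
noOnesLargest-gf : ∀ m r ℓ → gf (noOnesLargest (2 + m)) (box ℓ (r + (2 + m))) ≈[ suc ℓ ] U (2 + m) (2 + m)
noOnesLargest-gf m r zero = below λ where
  zero    _        → sym (U-at-0 (2 + m) (2 + m))
  (suc _) (s≤s ())
noOnesLargest-gf m zero (suc ℓ) = ≈[]-trans
  (gf-box (suc m)
    (≈[]-trans
      (below λ N _ → gf-cong (box ℓ (2 + m)) (λ {xs} _ _ →
        trans (cong (ones 0 xs ℤ.*_) (indicator-yes (2 + m ℕ.≟ 2 + m) refl)) (ℤ.*-identityʳ (ones 0 xs))))
      (ones-gf ℓ (suc m) 0))
    (gf-vanishes (box (suc ℓ) (suc m)) (λ {xs} xs∈ →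
      noOnesLargest-zero xs (ℕ.<⇒≢ (s≤s (box-largest (suc ℓ) (suc m) xs∈))))))
  (≈⇒≈[] (FPS.trans (FPS.+-identityʳ _) (FPS.*-congˡ (FPS.*-identityˡ (C ⊗ R (2 + m))))))
noOnesLargest-gf m (suc r) (suc ℓ) = ≈[]-trans
  (gf-box (r + (2 + m))
    (gf-vanishes (box ℓ (suc (r + (2 + m)))) (λ {xs} _ →
      noOnesLargest-zero (suc (r + (2 + m)) ∷ xs) (ℕ.>⇒≢ (s≤s (ℕ.m≤n+m (2 + m) r)))))
    (noOnesLargest-gf m r (suc ℓ)))
  (≈⇒≈[] (FPS.trans (FPS.+-congʳ (FPS.zeroʳ _)) (FPS.+-identityˡ _)))

-- The crank condition by number of ones

crankCase : ℕ → List ℕ → ℕ → ℤ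
crankCase x xs zero    = + x
crankCase x xs (suc w) = μ (x ∷ xs) ℤ.⊖ suc w

-- With the number of ones as an argument of `crankCase`, an equation for `ω` can be substituted by
-- `cong`.
crank-case : ∀ x xs → crank (x ∷ xs) ≡ crankCase x xs (ω (x ∷ xs))
crank-case x xs with ω (x ∷ xs)
... | zero  = refl
... | suc w = refl

crank-noOnes : ∀ x xs → ω (x ∷ xs) ≡ 0 → crank (x ∷ xs) ≡ + x
crank-noOnes x xs eq = trans (crank-case x xs) (cong (crankCase x xs) eq)

crank-ones : ∀ x xs {w} → ω (x ∷ xs) ≡ suc w → crank (x ∷ xs) ≡ large (suc w) (x ∷ xs) ℤ.⊖ suc w
crank-ones x xs {w} eq = trans (crank-case x xs)
  (trans (cong (crankCase x xs) eq) (cong (λ v → large v (x ∷ xs) ℤ.⊖ suc w) eq))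

⊖-≡⇔ : ∀ a w m → a ℤ.⊖ w ≡ + m ⇔ a ≡ w + m
⊖-≡⇔ a w m = mk⇔ to from
  where
  open ≡-Reasoning
  from : a ≡ w + m → a ℤ.⊖ w ≡ + m
  from refl = trans (cong (λ v → (w + m) ℤ.⊖ v) (sym (ℕ.+-identityʳ w))) (ℤ.+-cancelˡ-⊖ w m 0)
  to : a ℤ.⊖ w ≡ + m → a ≡ w + m
  to eq = ℤ.+-injective (begin
    + a                         ≡⟨⟩
    a ℤ.⊖ 0                       ≡⟨ ℤ.+-cancelˡ-⊖ w a 0 ⟨
    (w + a) ℤ.⊖ (w + 0)           ≡⟨ cong (λ v → (w + a) ℤ.⊖ v) (ℕ.+-identityʳ w) ⟩
    (w + a) ℤ.⊖ w                 ≡⟨ ℤ.distribʳ-⊖-+-pos w a w ⟨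
    + w ℤ.+ (a ℤ.⊖ w)             ≡⟨ cong (λ z → + w ℤ.+ z) eq ⟩
    + (w + m)                   ∎)

sum-single : ∀ {K v} (f : ℕ → ℤ) → v < K → (∀ i → i ≢ v → f i ≡ 0ℤ) → ∑[ i < K ] f (toℕ i) ≡ f v
sum-single {suc K} {zero}  f _ eq = trans (+-congˡ (f 0) (sum-zero K (λ i _ → eq (suc i) λ ()))) (ℤ.+-identityʳ (f 0))
sum-single {suc K} {suc v} f (s≤s v<K) eq = trans
  (cong₂ ℤ._+_ (eq 0 λ ()) (sum-single (f ∘ suc) v<K (λ i i≢v → eq (suc i) (i≢v ∘ ℕ.suc-injective))))
  (ℤ.+-identityˡ (f (suc v)))

onesLarge-zero : ∀ {w b} xs → ω xs ≢ w → onesLarge w b xs ≡ 0ℤ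
onesLarge-zero {w} {b} xs ≢w = cong (ℤ._* δ (large w xs) b) (indicator-no (ω xs ℕ.≟ w) ≢w)

-- The summands belong to different numbers of ones, so at most one is nonzero: the first if there
-- are no ones, otherwise the one with i + 1 ones. The bound K keeps that i in range.
crank-indicator : ∀ m K x xs → ω (x ∷ xs) ≤ K →
  indicator (crank (x ∷ xs) ℤ.≟ + m) ≡
  noOnesLargest m (x ∷ xs) ℤ.+ ∑[ i < K ] onesLarge (suc (toℕ i)) (suc (toℕ i) + m) (x ∷ xs)
crank-indicator m K x xs ω≤K = go (ω ys) refl
  where
  ys = x ∷ xs
  open ≡-Reasoning
  go : ∀ w → ω ys ≡ w → indicator (crank ys ℤ.≟ + m) ≡
       noOnesLargest m ys ℤ.+ ∑[ i < K ] onesLarge (suc (toℕ i)) (suc (toℕ i) + m) ys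
  go zero eq = begin
    indicator (crank ys ℤ.≟ + m)     ≡⟨ cong (λ c → indicator (c ℤ.≟ + m)) (crank-noOnes x xs eq) ⟩
    indicator (+ x ℤ.≟ + m)          ≡⟨ cong (if_then 1ℤ else 0ℤ) (does-⇔ (mk⇔ ℤ.+-injective (cong (λ a → + a))) (+ x ℤ.≟ + m) (x ℕ.≟ m)) ⟩
    δ x m                            ≡⟨ ℤ.*-identityˡ (δ x m) ⟨
    1ℤ ℤ.* δ x m                     ≡⟨ cong (ℤ._* δ x m) (indicator-yes (ω ys ℕ.≟ 0) eq) ⟨
    noOnesLargest m ys               ≡⟨ ℤ.+-identityʳ _ ⟨
    noOnesLargest m ys ℤ.+ 0ℤ        ≡⟨ +-congˡ (noOnesLargest m ys) (sum-zero K {λ i → onesLarge (suc i) (suc i + m) ys} (λ i _ → onesLarge-zero ys (λ eq′ → ℕ.0≢1+n (trans (sym eq) eq′)))) ⟨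
    noOnesLargest m ys ℤ.+ ∑[ i < K ] onesLarge (suc (toℕ i)) (suc (toℕ i) + m) ys ∎
  go (suc w) eq = begin
    indicator (crank ys ℤ.≟ + m)                     ≡⟨ cong (λ c → indicator (c ℤ.≟ + m)) (crank-ones x xs eq) ⟩
    indicator (large (suc w) ys ℤ.⊖ suc w ℤ.≟ + m)     ≡⟨ cong (if_then 1ℤ else 0ℤ) (does-⇔ (⊖-≡⇔ (large (suc w) ys) (suc w) m) (large (suc w) ys ℤ.⊖ suc w ℤ.≟ + m) (large (suc w) ys ℕ.≟ suc w + m)) ⟩
    δ (large (suc w) ys) (suc w + m)                 ≡⟨ ℤ.*-identityˡ (δ (large (suc w) ys) (suc w + m)) ⟨
    1ℤ ℤ.* δ (large (suc w) ys) (suc w + m)          ≡⟨ cong (ℤ._* δ (large (suc w) ys) (suc w + m)) (indicator-yes (ω ys ℕ.≟ suc w) eq) ⟨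
    onesLarge (suc w) (suc w + m) ys
      ≡⟨ sum-single (λ i → onesLarge (suc i) (suc i + m) ys) (subst (_≤ K) eq ω≤K)
           (λ i i≢w → onesLarge-zero ys (λ eq′ → i≢w (ℕ.suc-injective (trans (sym eq′) eq)))) ⟨
    ∑[ i < K ] onesLarge (suc (toℕ i)) (suc (toℕ i) + m) ys    ≡⟨ ℤ.+-identityˡ _ ⟨
    0ℤ ℤ.+ ∑[ i < K ] onesLarge (suc (toℕ i)) (suc (toℕ i) + m) ys
      ≡⟨ cong (ℤ._+ ∑[ i < K ] onesLarge (suc (toℕ i)) (suc (toℕ i) + m) ys)
           (cong (ℤ._* δ (largest ys) m) (indicator-no (ω ys ℕ.≟ 0) (λ eq′ → ℕ.0≢1+n (trans (sym eq′) eq)))) ⟨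
    noOnesLargest m ys ℤ.+ ∑[ i < K ] onesLarge (suc (toℕ i)) (suc (toℕ i) + m) ys ∎

box-ω : ∀ ℓ k {xs} → xs ∈ box ℓ k → ω xs ≤ ℓ
box-ω ℓ k {xs} xs∈ with _ , _ , l , _ ← box-sound ℓ k xs∈ = ℕ.≤-trans (length-filter (ℕ._≟ 1) xs) l

C-at : ∀ n → C (2 + n) ≡ 0ℤ
C-at n = ⊟-at 𝟙 (q^ 1) (2 + n)

crankTerm-0 : ∀ m → crankTerm m 0 ≈ U m m
crankTerm-0 m = begin
  q^ (m * 1) ⊗ (C ⊗ (R 0 ⊗ R m))    ≡⟨ cong (λ a → q^ a ⊗ (C ⊗ (R 0 ⊗ R m))) (ℕ.*-identityʳ m) ⟩
  q^ m ⊗ (C ⊗ (R 0 ⊗ R m))          ≈⟨ FPS.*-congˡ (FPS.*-congˡ (FPS.trans (FPS.*-congʳ R-0) (FPS.*-identityˡ (R m)))) ⟩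
  q^ m ⊗ (C ⊗ R m)                  ∎
  where open ≈-Reasoning

U-00 : U 0 0 ≈ C
U-00 = FPS.trans (FPS.*-identityˡ _) (FPS.trans (FPS.*-congˡ R-0) (FPS.*-identityʳ C))

-- For m = 0 and m = 1 no such partition has size at least 2, and `U 0 0` = 1 - q and `U 1 1` = q
-- have no coefficients there. For m above the size both sides vanish again.
noOnesLargest-coefficient : ∀ m n → gf (noOnesLargest m) (box (2 + n) (2 + n)) (2 + n) ≡ U m m (2 + n)
noOnesLargest-coefficient zero n = trans
  (gf-zero (box (2 + n) (2 + n)) (λ {xs} xs∈ s → zero-largest xs xs∈ s))
  (sym (trans (at U-00 (2 + n)) (C-at n)))
  where
  zero-largest : ∀ xs → xs ∈ box (2 + n) (2 + n) → sumℕ xs ≡ 2 + n → noOnesLargest 0 xs ≡ 0ℤ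
  zero-largest (x ∷ xs) xs∈ _ with _ , p ∷ _ , _ ← box-sound (2 + n) (2 + n) xs∈ = noOnesLargest-zero (x ∷ xs) (ℕ.>⇒≢ p)
noOnesLargest-coefficient (suc zero) n = trans
  (gf-zero (box (2 + n) (2 + n)) (λ {xs} _ _ → one-largest xs))
  (sym (at (U-1 1) (2 + n)))
  where
  one-largest : ∀ xs → noOnesLargest 1 xs ≡ 0ℤ
  one-largest []                 = refl
  one-largest (zero ∷ xs)        = noOnesLargest-zero {1} (zero ∷ xs) λ ()
  one-largest (suc zero ∷ xs)    = refl
  one-largest (suc (suc x) ∷ xs) = noOnesLargest-zero {1} (suc (suc x) ∷ xs) λ ()
noOnesLargest-coefficient (suc (suc m)) n with 2 + m ℕ.≤? 2 + n
... | yes m≤n = subst (λ k → gf (noOnesLargest (2 + m)) (box (2 + n) k) (2 + n) ≡ U (2 + m) (2 + m) (2 + n))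
  (ℕ.m∸n+n≡m m≤n) (at< (noOnesLargest-gf m (2 + n ∸ (2 + m)) (2 + n)) (2 + n) ℕ.≤-refl)
... | no m≰n = trans
  (gf-zero (box (2 + n) (2 + n)) (λ {xs} xs∈ _ → noOnesLargest-zero xs
    (ℕ.<⇒≢ (ℕ.≤-<-trans (box-largest (2 + n) (2 + n) xs∈) (ℕ.≰⇒> m≰n)))))
  (sym (q^⊗-at (C ⊗ R (2 + m)) (ℕ.≰⇒> m≰n)))

onesLarge-coefficient : ∀ m w n → w < n →
  gf (onesLarge (suc w) (suc w + m)) (box n n) n ≡ crankTerm m (suc w) n
onesLarge-coefficient m w n w<n = begin
  gf (onesLarge (suc w) (suc w + m)) (box n n) n
    ≡⟨ cong (λ k → gf (onesLarge (suc w) (suc w + m)) (box n k) n) r+w≡n ⟨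
  gf (onesLarge (suc w) (suc w + m)) (box n (r + suc w)) n
    ≡⟨ at< (onesLarge-gf w r (suc w + m) n) n ℕ.≤-refl ⟩
  V (suc w) r (suc w + m) n
    ≡⟨ at< (V-limit (suc w) r m) n n< ⟩
  crankTerm m (suc w) n ∎
  where
  r = n ∸ suc w
  r+w≡n : r + suc w ≡ n
  r+w≡n = ℕ.m∸n+n≡m w<n
  e = (suc w + m) * suc (suc w)
  n< : n < suc w + e + r
  -- Since n = w + 1 + r, the modulus of `V-limit` exceeds n because e is positive.
  n< = ℕ.≤-trans
    (subst (λ a → suc a ≤ suc (suc w + r)) (trans (ℕ.+-comm (suc w) r) r+w≡n) ℕ.≤-refl)
    (ℕ.+-monoˡ-≤ r (subst (_≤ suc w + e) (ℕ.+-comm (suc w) 1) (ℕ.+-monoʳ-≤ (suc w) (s≤s z≤n))))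
  open ≡-Reasoning

crank-gf : ∀ m N → M (+ m) N ≡ ∑[ w < suc N ] crankTerm m (toℕ w) N
crank-gf m zero = sym (trans (ℤ.+-identityʳ _) (trans (at (crankTerm-0 m) 0) (trans (U-at-0 m m) (δ0m m))))
  where
  δ0m : ∀ m → δ 0 m ≡ M₀ (+ m)
  δ0m zero    = refl
  δ0m (suc m) = refl
-- The summand w = 1 has order at least 1 + 2(1 + m), so only w = 0 reaches degree 1.
crank-gf m (suc zero) = sym (trans
  (cong₂ ℤ._+_ (at (crankTerm-0 m) 1)
    (trans (ℤ.+-identityʳ _) (q^⊗-at (C ⊗ (R 1 ⊗ R (1 + m))) (s≤s (s≤s z≤n)))))
  (trans (ℤ.+-identityʳ (U m m 1)) (go m)))
  where
  go : ∀ m → U m m 1 ≡ M₁ (+ m)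
  go zero          = trans (at U-00 1) (⊟-at 𝟙 (q^ 1) 1)
  go (suc zero)    = at (U-1 1) 1
  go (suc (suc m)) = q^⊗-at (C ⊗ R (2 + m)) (s≤s (s≤s z≤n))
crank-gf m n@(suc (suc n′)) = begin
  + length (filter (λ xs → crank xs ℤ.≟ + m) (partitions n))
    ≡⟨ gf-filter (λ xs → crank xs ℤ.≟ + m) (box n n) n ⟩
  gf (λ xs → indicator (crank xs ℤ.≟ + m)) (box n n) n
    ≡⟨ gf-cong (box n n) (λ {xs} → split xs) ⟩
  gf (λ xs → noOnesLargest m xs ℤ.+ ∑[ i < n ] onesLarge (suc (toℕ i)) (suc (toℕ i) + m) xs) (box n n) n
    ≡⟨ gf-+ (noOnesLargest m) (λ xs → ∑[ i < n ] onesLarge (suc (toℕ i)) (suc (toℕ i) + m) xs) (box n n) n ⟩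
  gf (noOnesLargest m) (box n n) n ℤ.+ gf (λ xs → ∑[ i < n ] onesLarge (suc (toℕ i)) (suc (toℕ i) + m) xs) (box n n) n
    ≡⟨ cong₂ ℤ._+_
         (trans (noOnesLargest-coefficient m n′) (sym (at (crankTerm-0 m) n)))
         (trans (gf-∑ n (λ i → onesLarge (suc i) (suc i + m)) (box n n) n)
           (sum-cong n {λ i → gf (onesLarge (suc i) (suc i + m)) (box n n) n} {λ i → crankTerm m (suc i) n}
             (λ i i<n → onesLarge-coefficient m i n i<n))) ⟩
  ∑[ w < suc n ] crankTerm m (toℕ w) n ∎
  where
  open ≡-Reasoning
  split : ∀ xs → xs ∈ box n n → sumℕ xs ≡ n → indicator (crank xs ℤ.≟ + m) ≡
          noOnesLargest m xs ℤ.+ ∑[ i < n ] onesLarge (suc (toℕ i)) (suc (toℕ i) + m) xs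
  -- The empty list is excluded because its sum is not n.
  split (x ∷ xs) xs∈ _ = crank-indicator m n x xs (box-ω n n xs∈)

-- Summation over the crank

-- By `crank-gf` and `durfeeSum-suc`, each crank value lowers the tail from j to j + 1; iterating k
-- times leaves the remainder `durfeeSum (j + k)`.
M-partial : ∀ k j N → ∑[ i < k ] M (+ (j + toℕ i)) N ℤ.+ durfeeSum (j + k) N ≡ durfeeSum j N
M-partial zero    j N = trans (ℤ.+-identityˡ _) (cong (λ a → durfeeSum a N) (ℕ.+-identityʳ j))
M-partial (suc k) j N = begin
  M (+ (j + 0)) N ℤ.+ ∑[ i < k ] M (+ (j + suc (toℕ i))) N ℤ.+ durfeeSum (j + suc k) N
    ≡⟨ ℤ.+-assoc (M (+ (j + 0)) N) _ _ ⟩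
  M (+ (j + 0)) N ℤ.+ (∑[ i < k ] M (+ (j + suc (toℕ i))) N ℤ.+ durfeeSum (j + suc k) N)
    ≡⟨ cong₂ (λ a b → M (+ a) N ℤ.+ b) (ℕ.+-identityʳ j)
         (cong₂ ℤ._+_ (sum-cong k (λ i _ → cong (λ a → M (+ a) N) (ℕ.+-suc j i))) (cong (λ a → durfeeSum a N) (ℕ.+-suc j k))) ⟩
  M (+ j) N ℤ.+ (∑[ i < k ] M (+ (suc j + toℕ i)) N ℤ.+ durfeeSum (suc j + k) N)
    ≡⟨ cong₂ ℤ._+_ (crank-gf j N) (M-partial k (suc j) N) ⟩
  ∑[ w < suc N ] crankTerm j (toℕ w) N ℤ.+ durfeeSum (suc j) N
    ≡⟨ durfeeSum-suc j N ⟨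
  durfeeSum j N ∎
  where open ≡-Reasoning

M-sums : ∀ j → (λ i → M (+ (j + i))) SumsTo durfeeSum j
-- From k = N + 1 on, the remainder has order at least j + k > N and drops out.
M-sums j N = suc N , λ k N<k → begin
  ∑[ i < k ] M (+ (j + toℕ i)) N                              ≡⟨ ℤ.+-identityʳ _ ⟨
  ∑[ i < k ] M (+ (j + toℕ i)) N ℤ.+ 0ℤ                       ≡⟨ cong (λ a → ∑[ i < k ] M (+ (j + toℕ i)) N ℤ.+ a) (durfeeSum-at (j + k) (ℕ.<-≤-trans N<k (ℕ.m≤n+m k j))) ⟨
  ∑[ i < k ] M (+ (j + toℕ i)) N ℤ.+ durfeeSum (j + k) N      ≡⟨ M-partial k j N ⟩
  durfeeSum j N                                               ∎
  where open ≡-Reasoning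

⊘-sums : ∀ j → (λ n → q^ ((n + 1) * (n + j)) ⊘ (poch (q^ 1) n ⊛ poch (q^ 1) (n + j))) SumsTo durfeeSum j
⊘-sums j N with K , eq ← term-sums j N =
  K , λ k K≤k → trans (sum-cong k (λ n _ → at (⊘≈term j n) N)) (eq k K≤k)

theorem2p1 : (j : ℕ) →
    ∃[ S ] (λ i → M (+ (j + i))) SumsTo S
    × (λ n → q^ ((n + 1) * (n + j)) ⊘ (poch (q^ 1) n ⊛ poch (q^ 1) (n + j))) SumsTo S
theorem2p1 j = durfeeSum j , M-sums j , ⊘-sums j
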